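{- Let $A$ be a finite alphabet, let $\phi: A^* \to A^*$ be a non-erasing morphism, and let $w \in A^{\mathbf{N}}$ be a pure morphic word generated by $\phi$, i.e. there exist a letter $b \in A$ and a nonempty word $u \in A^*$ with $\phi(b) = bu$ and $w = \lim_{i\to\infty} \phi^i(b)$ (so that $\phi(w) = w$). If for every letter $a \in A$ the frequency of $a$ in $w$ exists, then for every finite word $v \in A^*$ that is a factor of $w$, the frequency of $v$ in $w$ exists.
   Context: For an infinite word $w = w[1]w[2]w[3]\cdots$ and a finite nonempty word $v$ of length $k$, the (ordinary) frequency of $v$ in $w$ is $$\lim_{n\to\infty} \frac{\#\{ i : 1 \le i \le n,\ w[i]w[i+1]\cdots w[i+k-1] = v\}}{n},$$ if this limit exists. A morphism $\phi: A^*\to A^*$ is a monoid homomorphism of the free monoid; it is non-erasing if $\phi(a)$ is nonempty for every $a\in A$. A factor of $w$ is a finite word of the form $w[t]w[t+1]\cdots w[r]$ with $1\le t\le r$. -}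

module Defs where

open import Algebra.Morphism.Structures using (IsMonoidHomomorphism)
open import Data.Fin.Base using (Fin)
open import Data.Fin.Properties using (inj⇒≟)
open import Data.Integer.Base using (+_)
open import Data.List.Base using (List; []; _∷_; [_]; applyUpTo; filter; length; take; upTo; ++-[]-rawMonoid)
open import Data.List.Properties using (≡-dec)
open import Data.Nat.Base as ℕ using (ℕ; suc)
open import Data.Nat.GeneralisedArithmetic using (fold)
open import Data.Product.Base using (∃; ∃-syntax; _×_; proj₂)
open import Data.Rational.Base using (ℚ; 0ℚ; _/_; _+_; _-_; ∣_∣; _≤_; _<_)
open import Function.Bundles using (_↔_)
open import Function.Properties.Inverse using (↔⇒↣)
open import Relation.Binary.Definitions using (DecidableEquality)
open import Relation.Binary.PropositionalEquality.Core using (_≡_; _≢_)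

-- Bishop's real numbers: regular sequences of rationals, where the n-th term
-- (n = 0, 1, 2, …) approximates the real to within 1/(n+1).
record ℝ : Set where
  field
    approx  : ℕ → ℚ
    regular : ∀ m n → ∣ approx m - approx n ∣ ≤ + 1 / suc m + + 1 / suc n

open ℝ public

-- |q - x| ≤ ε in ℝ.  In Bishop's order, a real y is non-negative iff
-- - 1/(n+1) ≤ yₙ for all n; here this is applied to yₙ = ε - |q - xₙ|.
Within : ℚ → ℚ → ℝ → Set
Within ε q x = ∀ n → ∣ q - approx x n ∣ ≤ ε + + 1 / suc n

ConvergesTo : (ℕ → ℚ) → ℝ → Set
ConvergesTo s x = ∀ ε → 0ℚ < ε → ∃[ N ] ∀ n → N ℕ.≤ n → Within ε (s n) x

HasLimit : (ℕ → ℚ) → Set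
HasLimit s = ∃[ x ] ConvergesTo s x

Finite : Set → Set
Finite A = ∃[ m ] A ↔ Fin m

finite⇒≟ : ∀ {A} → Finite A → DecidableEquality A
finite⇒≟ fin = inj⇒≟ (↔⇒↣ (proj₂ fin))

-- Positions are counted from 0, so w i is the (i+1)-st letter of w.
InfiniteWord : Set → Set
InfiniteWord A = ℕ → A

module _ {A : Set} where

  -- The k letters of w starting at position i.
  slice : InfiniteWord A → ℕ → ℕ → List A
  slice w i k = applyUpTo (λ j → w (i ℕ.+ j)) k

  IsFactor : List A → InfiniteWord A → Set
  IsFactor v w = ∃[ t ] ∃[ k ] v ≡ slice w t (suc k)

  occurrences : Finite A → InfiniteWord A → List A → ℕ → ℕ
  occurrences fin w v n =
    length (filter (λ i → ≡-dec (finite⇒≟ fin) (slice w i (length v)) v) (upTo n))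

  -- The quotient is undefined at n = 0, so the sequence starts at n = 1.
  HasFrequency : Finite A → InfiniteWord A → List A → Set
  HasFrequency fin w v = HasLimit (λ n → + occurrences fin w v (suc n) / suc n)

  IsMorphism : (List A → List A) → Set
  IsMorphism = IsMonoidHomomorphism (++-[]-rawMonoid A) (++-[]-rawMonoid A)

  NonErasing : (List A → List A) → Set
  NonErasing φ = ∀ a → φ [ a ] ≢ []

  -- Convergence of finite words to an infinite word in the prefix topology.
  -- As slice w 0 n has length n, it forces the lengths of the xs i to be unbounded.
  IsLimitOfWords : (ℕ → List A) → InfiniteWord A → Set
  IsLimitOfWords xs w = ∀ n → ∃[ I ] ∀ i → I ℕ.≤ i → take n (xs i) ≡ slice w 0 n

  IsPureMorphicWord : (List A → List A) → InfiniteWord A → Set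
  IsPureMorphicWord φ w =
    ∃[ b ] ∃[ u ] u ≢ [] × φ [ b ] ≡ b ∷ u × IsLimitOfWords (fold [ b ] φ) w

{-# OPTIONS --safe #-}
-- If the prefixes φ ^ k (b) grow exponentially in k, then, as letter frequencies
-- exist, for large k every long prefix p is stretched by an arbitrarily large factor
-- |φ ^ k (p)| / |p|. Occurrences of v crossing the border of two blocks φ ^ k (a)
-- become negligible, and those inside the blocks are counted by letter frequencies.
-- Otherwise the length of φ ^ k (b), and the number of occurrences of v in it, are
-- quasi-polynomial in k with natural Newton coefficients; their quotient converges
-- along multiples of the period N, and |φ ^ (k + N) (b)| / |φ ^ k (b)| tends to 1,
-- which controls the prefixes in between.
module Submission where

open import Defs
open import Algebra.Morphism.Structures using (IsMonoidHomomorphism)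
open import Data.Empty using (⊥-elim)
open import Data.Fin.Base using (Fin; zero; suc; toℕ; combine; finToFun; funToFin)
open import Data.Fin.Induction using (spo-wellFounded)
import Data.Fin.Properties as Fin
open import Data.Integer.Base as ℤ using (+≤+) renaming (+_ to pos)
import Data.Integer.Properties as ℤ
open import Data.List.Base using (List; []; _∷_; [_]; _++_; length; map; take; drop; filter; tabulate; applyUpTo; upTo; allFin)
import Data.List.Membership.DecPropositional as DecMembership
open import Data.List.Membership.Propositional using (_∈_; _∉_)
open import Data.List.Membership.Propositional.Properties using (∈-allFin; ∈-map⁺)
open import Data.List.Properties using (≡-dec; ∷-injectiveˡ; take++drop≡id; upTo-∷ʳ; filter-++; length-++; length-applyUpTo; ++-cancelˡ; tabulate-cong)
import Data.List.Relation.Unary.All as All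
import Data.List.Relation.Unary.All.Properties as All
open import Data.List.Relation.Unary.Any using (here; there; _─_)
open import Data.Nat.Base hiding (_/_)
open import Data.Nat.Divisibility using (_∣_; divides)
open import Data.Nat.GeneralisedArithmetic using (fold; fold-+)
open import Data.Nat.ListAction using (sum; product)
open import Data.Nat.ListAction.Properties using (∈⇒∣product; product≢0)
open import Data.Nat.Properties
open import Data.Nat.Tactic.RingSolver using (solve-∀)
open import Data.Product.Base using (∃; ∃-syntax; _×_; _,_; proj₁; proj₂)
open import Data.Rational.Base as ℚ using (ℚ; 0ℚ; mkℚ; _/_; ∣_∣)
import Data.Rational.Properties as ℚ
open import Data.Rational.Unnormalised.Base as ℚᵘ using (mkℚᵘ)
import Data.Rational.Unnormalised.Properties as ℚᵘ
open import Data.Sum.Base using (_⊎_; inj₁; inj₂; map₁; [_,_]′)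
open import Algebra.Properties.Group ℚ.+-0-group using (//-rightDividesˡ; //-rightDividesʳ; ⁻¹-anti-homo-//)
open import Function.Base using (_∘_)
open import Function.Bundles using (_↔_; Inverse)
open import Induction.WellFounded using (Acc; acc)
open import Relation.Binary.Definitions using (tri<; tri≈; tri>)
open import Relation.Binary.PropositionalEquality hiding ([_]; J)
open import Relation.Binary.Structures using (IsStrictPartialOrder)
open import Relation.Nullary using (¬_; Dec; yes; no)
open import Relation.Nullary.Decidable using (_⊎-dec_; _×-dec_)
open import Relation.Unary using (Decidable)

-- Occurrences of `v` are not additive over the blocks φ ^ k (a), since one may straddle a border.
-- The polynomial case therefore runs on the substitution that φ induces on windows of length |v|:
-- there an occurrence of `v` is a single letter, and lengths and occurrence counts are two weights
-- of one iterated letter. The dichotomy is decided for the window at position 0, whose k-th iterate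
-- has exactly the length of φ ^ k (b), so its exponential half speaks about φ again. The dichotomy
-- itself comes from cycles. If two branches issuing from a cycle at a letter lead back to that
-- letter, its size doubles at a fixed rate. Otherwise everything that branches off the cycle is
-- lower in a well-founded order, and the weight s of the letter satisfies s (k + j) = s j + t j
-- with t already understood. Solving this recursion prepends one natural number to a Newton
-- expansion. Hence no coefficient is ever negative, a nonzero leading coefficient is positive, and
-- degrees can be compared. N is the product of the cycle lengths, so that all letters share one
-- step.

-- Limits of x n / n as inequalities between natural numbers

-- Says that x n / n is a Cauchy sequence: | x n / n - x m / m | ≤ 1 / e with denominators cleared.
Cauchy : (ℕ → ℕ) → Set
Cauchy x = ∀ e → ∃[ N ] ∀ m n → N ≤ m → N ≤ n →
  e * (x n * m) ≤ e * (x m * n) + m * n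

infix 8 _÷suc_
_÷suc_ : ℕ → ℕ → ℚ
a ÷suc n = pos a / suc n

÷suc-≃ : ∀ a n → ℚ.toℚᵘ (a ÷suc n) ℚᵘ.≃ mkℚᵘ (pos a) n
÷suc-≃ a n = ℚ.toℚᵘ-fromℚᵘ (mkℚᵘ (pos a) n)

+÷suc-≃ : ∀ a n b m → ℚ.toℚᵘ (a ÷suc n ℚ.+ b ÷suc m) ℚᵘ.≃ mkℚᵘ (pos a) n ℚᵘ.+ mkℚᵘ (pos b) m
+÷suc-≃ a n b m = ℚᵘ.≃-trans (ℚ.toℚᵘ-homo-+ (a ÷suc n) (b ÷suc m)) (ℚᵘ.+-cong (÷suc-≃ a n) (÷suc-≃ b m))

module _ {a n b m e : ℕ} where

  private
    num≡ : (pos b ℤ.* pos (suc e) ℤ.+ pos 1 ℤ.* pos (suc m)) ℤ.* pos (suc n) ≡ pos ((b * suc e + 1 * suc m) * suc n)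
    num≡ = trans (cong (ℤ._* pos (suc n)) (trans (cong₂ ℤ._+_ (sym (ℤ.pos-* b (suc e))) (sym (ℤ.pos-* 1 (suc m))))
      (sym (ℤ.pos-+ (b * suc e) (1 * suc m))))) (sym (ℤ.pos-* (b * suc e + 1 * suc m) (suc n)))

  ÷suc-≤⁺ : a * (suc m * suc e) ≤ (b * suc e + 1 * suc m) * suc n → a ÷suc n ℚ.≤ b ÷suc m ℚ.+ 1 ÷suc e
  ÷suc-≤⁺ h = ℚ.toℚᵘ-cancel-≤ (ℚᵘ.≤-respˡ-≃ (ℚᵘ.≃-sym (÷suc-≃ a n))
    (ℚᵘ.≤-respʳ-≃ (ℚᵘ.≃-sym (+÷suc-≃ b m 1 e))
    (ℚᵘ.*≤* (subst₂ ℤ._≤_ (ℤ.pos-* a (suc m * suc e)) (sym num≡) (+≤+ h)))))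

  ÷suc-≤⁻ : a ÷suc n ℚ.≤ b ÷suc m ℚ.+ 1 ÷suc e → a * (suc m * suc e) ≤ (b * suc e + 1 * suc m) * suc n
  ÷suc-≤⁻ h with ℚᵘ.≤-respˡ-≃ (÷suc-≃ a n) (ℚᵘ.≤-respʳ-≃ (+÷suc-≃ b m 1 e) (ℚ.toℚᵘ-mono-≤ h))
  ... | ℚᵘ.*≤* k = ℤ.drop‿+≤+ (subst₂ ℤ._≤_ (sym (ℤ.pos-* a (suc m * suc e))) num≡ k)

-- The denominator is 4 * (e + 1) in successor form. Four parts are needed because two ratios are
-- each compared with the limit, and each comparison costs ε plus the error 1/(n+1) of the
-- approximation.
quarters : ∀ e → let δ = 1 ÷suc (e + 3 * suc e) in (δ ℚ.+ δ) ℚ.+ (δ ℚ.+ δ) ≡ 1 ÷suc e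
quarters e = ℚ.toℚᵘ-injective (ℚᵘ.≃-trans (ℚ.toℚᵘ-homo-+ (δ ℚ.+ δ) (δ ℚ.+ δ))
  (ℚᵘ.≃-trans (ℚᵘ.+-cong (+÷suc-≃ 1 E 1 E) (+÷suc-≃ 1 E 1 E))
  (ℚᵘ.≃-trans (ℚᵘ.*≡* (cong pos (identity e))) (ℚᵘ.≃-sym (÷suc-≃ 1 e)))))
  where
  E = e + 3 * suc e
  δ = 1 ÷suc E
  identity : ∀ e → let d = suc (e + 3 * suc e) in
    ((1 * d + 1 * d) * (d * d) + (1 * d + 1 * d) * (d * d)) * suc e ≡ 1 * ((d * d) * (d * d))
  identity = solve-∀


p≤∣p∣ : ∀ p → p ℚ.≤ ∣ p ∣
p≤∣p∣ p with ℚ.≤-total 0ℚ p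
... | inj₁ 0≤p = ℚ.≤-reflexive (sym (ℚ.0≤p⇒∣p∣≡p 0≤p))
... | inj₂ p≤0 = ℚ.≤-trans p≤0 (ℚ.0≤∣p∣ p)

p-q+q≡p : ∀ p q → (p ℚ.- q) ℚ.+ q ≡ p
p-q+q≡p p q = //-rightDividesˡ q p

∣p-q∣≡∣q-p∣ : ∀ p q → ∣ p ℚ.- q ∣ ≡ ∣ q ℚ.- p ∣
∣p-q∣≡∣q-p∣ p q = trans (sym (ℚ.∣-p∣≡∣p∣ (p ℚ.- q))) (cong ∣_∣ (⁻¹-anti-homo-// p q))

p≤q+∣p-q∣ : ∀ p q → p ℚ.≤ q ℚ.+ ∣ p ℚ.- q ∣
p≤q+∣p-q∣ p q = begin
  p                    ≡⟨ p-q+q≡p p q ⟨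
  (p ℚ.- q) ℚ.+ q      ≡⟨ ℚ.+-comm (p ℚ.- q) q ⟩
  q ℚ.+ (p ℚ.- q)      ≤⟨ ℚ.+-monoʳ-≤ q (p≤∣p∣ (p ℚ.- q)) ⟩
  q ℚ.+ ∣ p ℚ.- q ∣    ∎
  where open ℚ.≤-Reasoning

p≤q+r⇒p-q≤r : ∀ {p q r} → p ℚ.≤ q ℚ.+ r → p ℚ.- q ℚ.≤ r
p≤q+r⇒p-q≤r {p} {q} {r} h = subst (p ℚ.- q ℚ.≤_)
  (trans (cong (ℚ._- q) (ℚ.+-comm q r)) (//-rightDividesʳ q r)) (ℚ.+-monoˡ-≤ (ℚ.- q) h)

∣p-q∣≤r⁺ : ∀ {p q r} → p ℚ.≤ q ℚ.+ r → q ℚ.≤ p ℚ.+ r → ∣ p ℚ.- q ∣ ℚ.≤ r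
∣p-q∣≤r⁺ {p} {q} h₁ h₂ with ℚ.∣p∣≡p∨∣p∣≡-p (p ℚ.- q)
... | inj₁ eq = subst (ℚ._≤ _) (sym eq) (p≤q+r⇒p-q≤r h₁)
... | inj₂ eq = subst (ℚ._≤ _) (sym (trans eq (⁻¹-anti-homo-// p q))) (p≤q+r⇒p-q≤r h₂)

0<1÷suc : ∀ e → 0ℚ ℚ.< 1 ÷suc e
0<1÷suc e = ℚ.toℚᵘ-cancel-< (ℚᵘ.<-respʳ-≃ (ℚᵘ.≃-sym (÷suc-≃ 1 e)) (ℚᵘ.*<* (ℤ.+<+ (s≤s z≤n))))

archimedean : ∀ ε → 0ℚ ℚ.< ε → ∃[ e ] 1 ÷suc e ℚ.≤ ε
archimedean (mkℚ (pos zero) d _) (ℚ.*<* (ℤ.+<+ ()))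
archimedean ε@(mkℚ (pos (suc n)) d _) _ = d , ℚ.toℚᵘ-cancel-≤ (ℚᵘ.≤-respˡ-≃ (ℚᵘ.≃-sym (÷suc-≃ 1 d))
  (ℚᵘ.*≤* (+≤+ (*-monoˡ-≤ (suc d) (s≤s {0} {n} z≤n)))))
archimedean (mkℚ (ℤ.-[1+ n ]) d _) (ℚ.*<* ())

ratio : (ℕ → ℕ) → ℕ → ℚ
ratio x n = x (suc n) ÷suc n

hasLimit⇒cauchy : ∀ {x} → HasLimit (ratio x) → Cauchy x
hasLimit⇒cauchy _ zero = 0 , λ _ _ _ _ → z≤n
hasLimit⇒cauchy {x} (y , lim) (suc e) with lim (1 ÷suc (e + 3 * suc e)) (0<1÷suc (e + 3 * suc e))
... | N , near = suc N , λ { (suc m) (suc n) (s≤s N≤m) (s≤s N≤n) →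
  subst₂ _≤_ (lhs e (x (suc n)) m) (rhs e (x (suc m)) m n)
    (÷suc-≤⁻ {x (suc n)} {n} {x (suc m)} {m} {e} (ratio≤ m n N≤m N≤n)) }
  where
  E = e + 3 * suc e
  δ = 1 ÷suc E
  lhs : ∀ e a m → a * (suc m * suc e) ≡ suc e * (a * suc m)
  lhs = solve-∀
  rhs : ∀ e b m n → (b * suc e + 1 * suc m) * suc n ≡ suc e * (b * suc n) + suc m * suc n
  rhs = solve-∀
  ratio≤ : ∀ m n → N ≤ m → N ≤ n → ratio x n ℚ.≤ ratio x m ℚ.+ 1 ÷suc e
  ratio≤ m n N≤m N≤n = begin
    ratio x n ≤⟨ p≤q+∣p-q∣ (ratio x n) z ⟩
    z ℚ.+ ∣ ratio x n ℚ.- z ∣ ≤⟨ ℚ.+-mono-≤ (p≤q+∣p-q∣ z (ratio x m)) (near n N≤n E) ⟩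
    (ratio x m ℚ.+ ∣ z ℚ.- ratio x m ∣) ℚ.+ (δ ℚ.+ δ) ≤⟨ ℚ.+-monoˡ-≤ (δ ℚ.+ δ) (ℚ.+-monoʳ-≤ (ratio x m)
       (subst (ℚ._≤ δ ℚ.+ δ) (∣p-q∣≡∣q-p∣ (ratio x m) z) (near m N≤m E))) ⟩
    (ratio x m ℚ.+ (δ ℚ.+ δ)) ℚ.+ (δ ℚ.+ δ) ≡⟨ ℚ.+-assoc (ratio x m) (δ ℚ.+ δ) (δ ℚ.+ δ) ⟩
    ratio x m ℚ.+ ((δ ℚ.+ δ) ℚ.+ (δ ℚ.+ δ)) ≡⟨ cong (ratio x m ℚ.+_) (quarters e) ⟩
    ratio x m ℚ.+ 1 ÷suc e ∎
    where open ℚ.≤-Reasoning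
          z = approx y E

-- The limit is read off diagonally: its e-th approximation is the ratio at the modulus for 1/(e+1).
-- Two such ratios are compared through an index beyond both moduli, so each contributes only its
-- own tolerance, as regularity demands.
cauchy⇒hasLimit : ∀ {x} → Cauchy x → HasLimit (ratio x)
cauchy⇒hasLimit {x} cauchy = limit , converges
  where
  modulus : ℕ → ℕ
  modulus e = proj₁ (cauchy (suc e))
  lhs : ∀ e a m → suc e * (a * suc m) ≡ a * (suc m * suc e)
  lhs = solve-∀
  rhs : ∀ e b m n → suc e * (b * suc n) + suc m * suc n ≡ (b * suc e + 1 * suc m) * suc n
  rhs = solve-∀
  ratio≤ : ∀ e m n → modulus e ≤ m → modulus e ≤ n → ratio x n ℚ.≤ ratio x m ℚ.+ 1 ÷suc e
  ratio≤ e m n p q = ÷suc-≤⁺ {x (suc n)} {n} {x (suc m)} {m} {e} (subst₂ _≤_ (lhs e (x (suc n)) m) (rhs e (x (suc m)) m n)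
    (proj₂ (cauchy (suc e)) (suc m) (suc n) (m≤n⇒m≤1+n p) (m≤n⇒m≤1+n q)))
  through : ∀ d e m n → modulus d ≤ m → modulus e ≤ n → ratio x m ℚ.≤ ratio x n ℚ.+ (1 ÷suc d ℚ.+ 1 ÷suc e)
  through d e m n p q = begin
    ratio x m                                      ≤⟨ ratio≤ d k m (≤-trans p (m≤m⊔n m n)) p ⟩
    ratio x k ℚ.+ 1 ÷suc d                         ≤⟨ ℚ.+-monoˡ-≤ (1 ÷suc d) (ratio≤ e n k q (≤-trans q (m≤n⊔m m n))) ⟩
    (ratio x n ℚ.+ 1 ÷suc e) ℚ.+ 1 ÷suc d          ≡⟨ ℚ.+-assoc (ratio x n) (1 ÷suc e) (1 ÷suc d) ⟩
    ratio x n ℚ.+ (1 ÷suc e ℚ.+ 1 ÷suc d)          ≡⟨ cong (ratio x n ℚ.+_) (ℚ.+-comm (1 ÷suc e) (1 ÷suc d)) ⟩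
    ratio x n ℚ.+ (1 ÷suc d ℚ.+ 1 ÷suc e)          ∎
    where open ℚ.≤-Reasoning
          k = m ⊔ n
  near : ∀ d e m n → modulus d ≤ m → modulus e ≤ n → ∣ ratio x m ℚ.- ratio x n ∣ ℚ.≤ 1 ÷suc d ℚ.+ 1 ÷suc e
  near d e m n p q = ∣p-q∣≤r⁺ (through d e m n p q)
    (subst (λ r → ratio x n ℚ.≤ ratio x m ℚ.+ r) (ℚ.+-comm (1 ÷suc e) (1 ÷suc d)) (through e d n m q p))
  regular′ : ∀ m n → ∣ ratio x (modulus m) ℚ.- ratio x (modulus n) ∣ ℚ.≤ 1 ÷suc m ℚ.+ 1 ÷suc n
  regular′ m n = near m n (modulus m) (modulus n) ≤-refl ≤-refl
  limit : ℝ
  limit = record { approx = λ e → ratio x (modulus e) ; regular = regular′ }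
  converges : ConvergesTo (ratio x) limit
  converges ε 0<ε with archimedean ε 0<ε
  ... | e , 1/e≤ε = modulus e , λ n p t → ℚ.≤-trans (near e t n (modulus t) p ≤-refl) (ℚ.+-monoˡ-≤ (1 ÷suc t) 1/e≤ε)

-- Newton polynomials and their quotients

-- Newton's forward-difference form: ⟦ c₀ ∷ c₁ ∷ … ⟧ j = Σ cᵢ * (j choose i).
⟦_⟧ : List ℕ → ℕ → ℕ
⟦ [] ⟧     j       = 0
⟦ c ∷ cs ⟧ zero    = c
⟦ c ∷ cs ⟧ (suc j) = ⟦ c ∷ cs ⟧ j + ⟦ cs ⟧ j

-- `⟦ basis n ⟧ j` is the binomial coefficient j choose n, the yardstick for degree n.
basis : ℕ → List ℕ
basis zero    = 1 ∷ []
basis (suc n) = 0 ∷ basis n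

length-basis : ∀ n → length (basis n) ≡ suc n
length-basis zero    = refl
length-basis (suc n) = cong suc (length-basis n)

⟦c∷0⟧ : ∀ c cs → (∀ j → ⟦ cs ⟧ j ≡ 0) → ∀ j → ⟦ c ∷ cs ⟧ j ≡ c
⟦c∷0⟧ c cs cs≡0 zero    = refl
⟦c∷0⟧ c cs cs≡0 (suc j) = trans (cong₂ _+_ (⟦c∷0⟧ c cs cs≡0 j) (cs≡0 j)) (+-identityʳ c)

Eventually : (ℕ → Set) → Set
Eventually P = ∃[ J ] ∀ j → J ≤ j → P j

eventually-from : ∀ {P : ℕ → Set} J → (∀ i → P (J + i)) → ∀ j → J ≤ j → P j
eventually-from {P} J h j J≤j = subst P (m+[n∸m]≡n J≤j) (h (j ∸ J))

Unbounded : (ℕ → ℕ) → Set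
Unbounded y = ∀ M → Eventually λ j → M ≤ y j

infix 4 _≪_
-- Little-o, with tolerance 1/m and the denominator cleared.
_≪_ : (ℕ → ℕ) → (ℕ → ℕ) → Set
x ≪ y = ∀ m → Eventually λ j → m * x j ≤ y j

≪-+ : ∀ {x x′ y} → x ≪ y → x′ ≪ y → (λ j → x j + x′ j) ≪ y
≪-+ {x} {x′} {y} p q m with p (2 * m) | q (2 * m)
... | J , h | J′ , h′ = J ⊔ J′ , λ j J≤j → *-cancelˡ-≤ 2 (begin
  2 * (m * (x j + x′ j))          ≡⟨ identity m (x j) (x′ j) ⟩
  2 * m * x j + 2 * m * x′ j      ≤⟨ +-mono-≤ (h j (m⊔n≤o⇒m≤o J J′ J≤j)) (h′ j (m⊔n≤o⇒n≤o J J′ J≤j)) ⟩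
  y j + y j                       ≡⟨ cong (y j +_) (+-identityʳ (y j)) ⟨
  2 * y j                         ∎)
  where
  open ≤-Reasoning
  identity : ∀ m a b → 2 * (m * (a + b)) ≡ 2 * m * a + 2 * m * b
  identity = solve-∀

≪-* : ∀ {x y} c → x ≪ y → (λ j → c * x j) ≪ y
≪-* {x} c p m with p (m * c)
... | J , h = J , λ j J≤j → ≤-trans (≤-reflexive (sym (*-assoc m c (x j)))) (h j J≤j)

≪-≤ : ∀ {x y z} → x ≪ y → (∀ j → y j ≤ z j) → x ≪ z
≪-≤ p y≤z m with p m
... | J , h = J , λ j J≤j → ≤-trans (h j J≤j) (y≤z j)

-- Discrete l'Hôpital: x′ and y′ are the difference sequences of x and y.
stolz : ∀ {x y x′ y′} → (∀ j → x (suc j) ≡ x j + x′ j) → (∀ j → y (suc j) ≡ y j + y′ j) →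
  Unbounded y → x′ ≪ y′ → x ≪ y
stolz {x} {y} {x′} {y′} Δx Δy unb p m with p (2 * m)
-- Summing from `J` on leaves the constant `2 * m * x J`. The factor 2 reserves one half of the
-- budget for it, once y has outgrown it.
... | J , h with unb (2 * m * x J)
... | J′ , h′ = J ⊔ J′ , λ j J≤j → *-cancelˡ-≤ 2 (begin
  2 * (m * x j)            ≡⟨ *-assoc 2 m (x j) ⟨
  2 * m * x j              ≤⟨ eventually-from {λ j → 2 * m * x j ≤ 2 * m * x J + y j} J summed j (m⊔n≤o⇒m≤o J J′ J≤j) ⟩
  2 * m * x J + y j        ≤⟨ +-monoˡ-≤ (y j) (h′ j (m⊔n≤o⇒n≤o J J′ J≤j)) ⟩
  y j + y j                ≡⟨ cong (y j +_) (+-identityʳ (y j)) ⟨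
  2 * y j                  ∎)
  where
  open ≤-Reasoning
  summed : ∀ i → 2 * m * x (J + i) ≤ 2 * m * x J + y (J + i)
  summed zero = ≤-trans (≤-reflexive (cong (λ j → 2 * m * x j) (+-identityʳ J))) (m≤m+n _ _)
  summed (suc i) = begin
    2 * m * x (J + suc i)                              ≡⟨ cong (λ j → 2 * m * x j) (+-suc J i) ⟩
    2 * m * x (suc (J + i))                            ≡⟨ cong (2 * m *_) (Δx (J + i)) ⟩
    2 * m * (x (J + i) + x′ (J + i))                   ≡⟨ *-distribˡ-+ (2 * m) (x (J + i)) (x′ (J + i)) ⟩
    2 * m * x (J + i) + 2 * m * x′ (J + i)             ≤⟨ +-mono-≤ (summed i) (h (J + i) (m≤m+n J i)) ⟩
    (2 * m * x J + y (J + i)) + y′ (J + i)             ≡⟨ +-assoc (2 * m * x J) (y (J + i)) (y′ (J + i)) ⟩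
    2 * m * x J + (y (J + i) + y′ (J + i))             ≡⟨ cong (2 * m * x J +_) (Δy (J + i)) ⟨
    2 * m * x J + y (suc (J + i))                      ≡⟨ cong (λ j → 2 * m * x J + y j) (+-suc J i) ⟨
    2 * m * x J + y (J + suc i)                        ∎

-- Mutual induction on the degree: an eventually positive difference sequence forces at least linear
-- growth, and an unbounded sequence is eventually positive.
basis-unbounded : ∀ n → Unbounded ⟦ basis (suc n) ⟧
basis-positive : ∀ n → Eventually λ j → 1 ≤ ⟦ basis n ⟧ j

basis-unbounded n M with basis-positive n
... | J , h = J + M , λ j J+M≤j →
  ≤-trans (m+n≤o⇒m≤o∸n M (≤-trans (≤-reflexive (+-comm M J)) J+M≤j))
    (eventually-from {λ j → j ∸ J ≤ ⟦ basis (suc n) ⟧ j} J (λ i → ≤-trans (≤-reflexive (m+n∸m≡n J i)) (linear i)) j (m+n≤o⇒m≤o J J+M≤j))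
  where
  linear : ∀ i → i ≤ ⟦ basis (suc n) ⟧ (J + i)
  linear zero    = z≤n
  linear (suc i) = subst (λ j → suc i ≤ ⟦ basis (suc n) ⟧ j) (sym (+-suc J i))
    (≤-trans (≤-reflexive (+-comm 1 i)) (+-mono-≤ (linear i) (h (J + i) (m≤m+n J i))))

basis-positive zero    = 0 , λ j _ → ≤-reflexive (sym (⟦c∷0⟧ 1 [] (λ _ → refl) j))
basis-positive (suc n) = basis-unbounded n 1

-- Such a list has degree below n. Taking tails on both sides takes differences, so `stolz` descends
-- to the empty list.
short≪basis : ∀ es n → length es ≤ n → ⟦ es ⟧ ≪ ⟦ basis n ⟧
short≪basis []       n       _       m = 0 , λ j _ → ≤-trans (≤-reflexive (*-zeroʳ m)) z≤n
short≪basis (e ∷ es) (suc n) (s≤s l) = stolz (λ _ → refl) (λ _ → refl) (basis-unbounded n) (short≪basis es n l)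

-- Storing the predecessor of the coefficient builds in positivity; the bound on the length of
-- `lower` says that its degree is below n.
record HasLeadingTerm (x : ℕ → ℕ) (n : ℕ) : Set where
  constructor leadingTerm
  field
    coefficient∸1 : ℕ
    lower         : List ℕ
    lower-length  : length lower ≤ n
    expansion     : ∀ j → x j ≡ ⟦ lower ⟧ j + suc coefficient∸1 * ⟦ basis n ⟧ j

  basis≤ : ∀ j → ⟦ basis n ⟧ j ≤ x j
  basis≤ j = subst (⟦ basis n ⟧ j ≤_) (sym (expansion j)) (≤-trans (m≤m+n _ _) (m≤n+m _ (⟦ lower ⟧ j)))

  ≪basis : ∀ {n′} → n < n′ → x ≪ ⟦ basis n′ ⟧
  ≪basis {n′} n<n′ m with
    ≪-+ (short≪basis lower n′ (≤-trans lower-length (<⇒≤ n<n′)))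
        (≪-* (suc coefficient∸1) (short≪basis (basis n) n′ (≤-trans (≤-reflexive (length-basis n)) n<n′))) m
  ... | J , k = J , λ j J≤j → subst (λ a → m * a ≤ ⟦ basis n′ ⟧ j) (sym (expansion j)) (k j J≤j)

antidifference-leading : ∀ {es n} e → HasLeadingTerm ⟦ es ⟧ n → HasLeadingTerm ⟦ e ∷ es ⟧ (suc n)
antidifference-leading {es} {n} e (leadingTerm c cs l h) = leadingTerm c (e ∷ cs) (s≤s l) expand
  where
  identity : ∀ a b c p q → (a + c * p) + (b + c * q) ≡ (a + b) + c * (p + q)
  identity = solve-∀
  expand : ∀ j → ⟦ e ∷ es ⟧ j ≡ ⟦ e ∷ cs ⟧ j + suc c * ⟦ basis (suc n) ⟧ j
  expand zero    = sym (trans (cong (e +_) (*-zeroʳ c)) (+-identityʳ e))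
  expand (suc j) = trans (cong₂ _+_ (expand j) (h j))
    (identity (⟦ e ∷ cs ⟧ j) (⟦ cs ⟧ j) (suc c) (⟦ basis (suc n) ⟧ j) (⟦ basis n ⟧ j))

leading? : ∀ es → (∀ j → ⟦ es ⟧ j ≡ 0) ⊎ ∃ (HasLeadingTerm ⟦ es ⟧)
leading? [] = inj₁ λ _ → refl
leading? (e ∷ es) with leading? es
leading? (e ∷ es)     | inj₂ (n , t) = inj₂ (suc n , antidifference-leading e t)
leading? (zero ∷ es)  | inj₁ es≡0 = inj₁ (⟦c∷0⟧ 0 es es≡0)
leading? (suc e ∷ es) | inj₁ es≡0 = inj₂ (0 , leadingTerm e [] z≤n λ j → trans (⟦c∷0⟧ (suc e) es es≡0 j)
  (sym (trans (cong (suc e *_) (⟦c∷0⟧ 1 [] (λ _ → refl) j)) (*-identityʳ (suc e)))))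

-- x / y tends to c / d.
HasRatio : (ℕ → ℕ) → (ℕ → ℕ) → ℕ → ℕ → Set
HasRatio x y c d = ∀ m → Eventually λ j → m * (d * x j) ≤ m * (c * y j) + y j × m * (c * y j) ≤ m * (d * x j) + y j

≪⇒ratio0 : ∀ {x y} → x ≪ y → HasRatio x y 0 1
≪⇒ratio0 {x} {y} p m with p m
... | J , h = J , λ j J≤j →
  ≤-trans (≤-trans (≤-reflexive (cong (m *_) (*-identityˡ (x j)))) (h j J≤j)) (m≤n+m (y j) (m * 0)) ,
  ≤-trans (≤-reflexive (*-zeroʳ m)) z≤n

-- Multiplied crosswise by the leading coefficients, the top terms agree; the remaining lower terms
-- are negligible against the binomial, hence against y.
equal-degree-ratio : ∀ {x y n} → HasLeadingTerm x n → HasLeadingTerm y n → ∃[ p ] ∃[ q ] HasRatio x y p (suc q)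
equal-degree-ratio {x} {y} {n} (leadingTerm c cs l h) t@(leadingTerm d ds l′ h′) = suc c , d , ratio′
  where
  open HasLeadingTerm t using (basis≤)
  identity : ∀ m p q r t → m * (p * (r + q * t)) ≡ m * (q * (p * t)) + m * (p * r)
  identity = solve-∀
  cross : ∀ m p q {u v} r s t {z} → u ≡ r + q * t → v ≡ s + p * t → m * (p * r) ≤ z →
    m * (p * u) ≤ m * (q * v) + z
  cross m p q r s t refl refl small = ≤-trans (≤-reflexive (identity m p q r t))
    (+-mono-≤ (*-monoʳ-≤ m (*-monoʳ-≤ q (m≤n+m (p * t) s))) small)
  ratio′ : HasRatio x y (suc c) (suc d)
  ratio′ m with ≪-≤ (≪-* (suc d) (short≪basis cs n l)) basis≤ m
             | ≪-≤ (≪-* (suc c) (short≪basis ds n l′)) basis≤ m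
  ... | J , g | J′ , g′ = J ⊔ J′ , λ j J≤j →
    cross m (suc d) (suc c) (⟦ cs ⟧ j) (⟦ ds ⟧ j) (⟦ basis n ⟧ j) (h j) (h′ j) (g j (m⊔n≤o⇒m≤o J J′ J≤j)) ,
    cross m (suc c) (suc d) (⟦ ds ⟧ j) (⟦ cs ⟧ j) (⟦ basis n ⟧ j) (h′ j) (h j) (g′ j (m⊔n≤o⇒n≤o J J′ J≤j))

-- The bound j ≤ y j excludes a constant y, so y has degree one more than its difference `⟦ ds ⟧`.
-- The bound x ≤ y keeps the degree of x from being larger, which leaves ratio 0 or the quotient of
-- the leading coefficients.
newton-ratio : ∀ cs d ds → let x = ⟦ cs ⟧ ; y = ⟦ d ∷ ds ⟧ in (∀ j → x j ≤ y j) → (∀ j → j ≤ y j) →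
  (∃[ p ] ∃[ q ] HasRatio x y p (suc q)) × ⟦ ds ⟧ ≪ y
newton-ratio cs d ds x≤y j≤y with leading? ds
... | inj₁ ds≡0 = ⊥-elim (<-irrefl refl (subst (suc d ≤_) (⟦c∷0⟧ d ds ds≡0 (suc d)) (j≤y (suc d))))
... | inj₂ (n , t) = go (leading? cs) , ≪-≤ (HasLeadingTerm.≪basis t ≤-refl) basis≤
  where
  x y : ℕ → ℕ
  x = ⟦ cs ⟧
  y = ⟦ d ∷ ds ⟧
  t′ : HasLeadingTerm y (suc n)
  t′ = antidifference-leading d t
  open HasLeadingTerm t′
  go : (∀ j → x j ≡ 0) ⊎ ∃ (HasLeadingTerm x) → ∃[ p ] ∃[ q ] HasRatio x y p (suc q)
  go (inj₁ x≡0) = 0 , 0 , ≪⇒ratio0 {x} {y} λ m → 0 , λ j _ →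
    subst (λ a → m * a ≤ y j) (sym (x≡0 j)) (≤-trans (≤-reflexive (*-zeroʳ m)) z≤n)
  go (inj₂ (n′ , u)) with <-cmp n′ (suc n)
  ... | tri< n′<n _ _ = 0 , 0 , ≪⇒ratio0 {x} {y} (≪-≤ (HasLeadingTerm.≪basis u n′<n) basis≤)
  ... | tri≈ _ refl _ = equal-degree-ratio u t′
  -- A larger degree of x would give 2 * y ≤ x ≤ y eventually. The index `suc J` instead of `J`
  -- makes y positive there.
  ... | tri> _ _ n<n′ with ≪basis n<n′ 2
  ...   | J , g = ⊥-elim (<-irrefl refl (begin-strict
    y (suc J)                  <⟨ m<m+n (y (suc J)) (≤-trans (s≤s z≤n) (≤-trans (j≤y (suc J)) (m≤m+n _ 0))) ⟩
    2 * y (suc J)              ≤⟨ g (suc J) (n≤1+n J) ⟩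
    ⟦ basis n′ ⟧ (suc J)       ≤⟨ HasLeadingTerm.basis≤ u (suc J) ⟩
    x (suc J)                  ≤⟨ x≤y (suc J) ⟩
    y (suc J)                  ∎))
    where open ≤-Reasoning

-- Growth dichotomy for substitutions

addCoefficients : List ℕ → List ℕ → List ℕ
addCoefficients []       ds       = ds
addCoefficients cs       []       = cs
addCoefficients (c ∷ cs) (d ∷ ds) = c + d ∷ addCoefficients cs ds

⟦⟧-+ : ∀ cs ds j → ⟦ addCoefficients cs ds ⟧ j ≡ ⟦ cs ⟧ j + ⟦ ds ⟧ j
⟦⟧-+ []       ds       j       = refl
⟦⟧-+ (c ∷ cs) []       j       = sym (+-identityʳ _)
⟦⟧-+ (c ∷ cs) (d ∷ ds) zero    = refl
⟦⟧-+ (c ∷ cs) (d ∷ ds) (suc j) = trans (cong₂ _+_ (⟦⟧-+ (c ∷ cs) (d ∷ ds) j) (⟦⟧-+ cs ds j))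
  (identity (⟦ c ∷ cs ⟧ j) (⟦ d ∷ ds ⟧ j) (⟦ cs ⟧ j) (⟦ ds ⟧ j))
  where
  identity : ∀ a b p q → (a + b) + (p + q) ≡ (a + p) + (b + q)
  identity = solve-∀

-- All late starting points r are allowed, not just one per residue class modulo N, which makes sums
-- and shifts immediate.
record QuasiPolynomial (N : ℕ) (s : ℕ → ℕ) : Set where
  constructor quasi
  field
    eventually-newton : Eventually λ r → ∃[ cs ] ∀ i → s (r + i * N) ≡ ⟦ cs ⟧ i

open QuasiPolynomial

module _ {N : ℕ} where

  quasi-0 : QuasiPolynomial N (λ _ → 0)
  quasi-0 = quasi (0 , λ _ _ → [] , λ _ → refl)

  quasi-+ : ∀ {s s′} → QuasiPolynomial N s → QuasiPolynomial N s′ → QuasiPolynomial N (λ j → s j + s′ j)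
  quasi-+ (quasi (J , h)) (quasi (J′ , h′)) = quasi (J ⊔ J′ , λ r J≤r →
    let cs , e = h r (m⊔n≤o⇒m≤o J J′ J≤r) ; ds , f = h′ r (m⊔n≤o⇒n≤o J J′ J≤r) in
    addCoefficients cs ds , λ i → trans (cong₂ _+_ (e i) (f i)) (sym (⟦⟧-+ cs ds i)))

  quasi-sum : ∀ {B : Set} (f : B → ℕ → ℕ) bs → (∀ b → b ∈ bs → QuasiPolynomial N (f b)) →
    QuasiPolynomial N (λ j → sum (map (λ b → f b j) bs))
  quasi-sum f []       h = quasi-0
  quasi-sum f (b ∷ bs) h = quasi-+ (h b (here refl)) (quasi-sum f bs (λ c c∈bs → h c (there c∈bs)))

  quasi-shift : ∀ {s} k → QuasiPolynomial N s → QuasiPolynomial N (λ j → s (k + j))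
  quasi-shift {s} k (quasi (J , h)) = quasi (J , λ r J≤r →
    let cs , e = h (k + r) (≤-trans J≤r (m≤n+m r k)) in
    cs , λ i → trans (cong s (sym (+-assoc k r (i * N)))) (e i))

  quasi-unshift : ∀ {s} → QuasiPolynomial N (λ j → s (suc j)) → QuasiPolynomial N s
  quasi-unshift (quasi (J , h)) = quasi (suc J , λ { (suc r) (s≤s J≤r) → h r J≤r })

  -- With N = m * k, one step of length N adds `T m`, the sum of m shifted copies of t. A Newton
  -- list for `T m` becomes one for s by prepending the initial value.
  quasi-antidifference : ∀ {s t} k → k ∣ N → (∀ j → s (k + j) ≡ s j + t j) → QuasiPolynomial N t → QuasiPolynomial N s
  quasi-antidifference {s} {t} k (divides m refl) Δs qt =
    quasi (proj₁ qTm , λ r J≤r → let cs , e = proj₂ qTm r J≤r in s r ∷ cs , newton r cs e)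
    where
    T : ℕ → ℕ → ℕ
    T zero    j = 0
    T (suc h) j = T h j + t (h * k + j)
    qT : ∀ h → QuasiPolynomial N (T h)
    qT zero    = quasi-0
    qT (suc h) = quasi-+ (qT h) (quasi-shift (h * k) qt)
    qTm = eventually-newton (qT m)
    ΔT : ∀ h j → s (h * k + j) ≡ s j + T h j
    ΔT zero    j = sym (+-identityʳ (s j))
    ΔT (suc h) j = trans (cong s (+-assoc k (h * k) j)) (trans (Δs (h * k + j))
      (trans (cong (_+ t (h * k + j)) (ΔT h j)) (+-assoc (s j) (T h j) (t (h * k + j)))))
    rearrange : ∀ r i n → r + (n + i) ≡ n + (r + i)
    rearrange = solve-∀
    newton : ∀ r cs → (∀ i → T m (r + i * (m * k)) ≡ ⟦ cs ⟧ i) → ∀ i → s (r + i * (m * k)) ≡ ⟦ s r ∷ cs ⟧ i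
    newton r cs e zero    = cong s (+-identityʳ r)
    newton r cs e (suc i) = trans (cong s (rearrange r (i * (m * k)) (m * k)))
      (trans (ΔT m (r + i * (m * k))) (cong₂ _+_ (newton r cs e i) (e i)))

module _ {B : Set} (f : B → ℕ) where

  sum-─ : ∀ {x xs} (x∈xs : x ∈ xs) → sum (map f xs) ≡ f x + sum (map f (xs ─ x∈xs))
  sum-─ (here refl) = refl
  sum-─ {x} {y ∷ _} (there x∈xs) = trans (cong (f y +_) (sum-─ x∈xs)) (swap (f y) (f x) _)
    where
    swap : ∀ a b c → a + (b + c) ≡ b + (a + c)
    swap = solve-∀

  ∈⇒≤sum : ∀ {x xs} → x ∈ xs → f x ≤ sum (map f xs)
  ∈⇒≤sum x∈xs = ≤-trans (m≤m+n _ _) (≤-reflexive (sym (sum-─ x∈xs)))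

  -- The letters x and y may be equal: only one occurrence is deleted, so two copies of a letter
  -- count as two branches.
  ∈∈⇒≤sum : ∀ {x y xs} (x∈xs : x ∈ xs) → y ∈ (xs ─ x∈xs) → f x + f y ≤ sum (map f xs)
  ∈∈⇒≤sum {x} x∈xs y∈ = ≤-trans (+-monoʳ-≤ (f x) (∈⇒≤sum y∈)) (≤-reflexive (sym (sum-─ x∈xs)))

∈-─⁻ : ∀ {B : Set} {x y : B} {xs} (x∈xs : x ∈ xs) → y ∈ (xs ─ x∈xs) → y ∈ xs
∈-─⁻ (here _)     y∈         = there y∈
∈-─⁻ (there x∈xs) (here eq)  = here eq
∈-─⁻ (there x∈xs) (there y∈) = there (∈-─⁻ x∈xs y∈)

some-or-all : ∀ {B : Set} {P Q : B → Set} ys → (∀ y → y ∈ ys → P y ⊎ Q y) →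
  (∃[ y ] y ∈ ys × P y) ⊎ (∀ y → y ∈ ys → Q y)
some-or-all [] h = inj₂ λ _ ()
some-or-all (y ∷ ys) h with h y (here refl) | some-or-all ys (λ z z∈ → h z (there z∈))
... | inj₁ p | _                  = inj₁ (y , here refl , p)
... | inj₂ q | inj₁ (z , z∈ , p)  = inj₁ (z , there z∈ , p)
... | inj₂ q | inj₂ qs            = inj₂ λ { _ (here refl) → q ; z (there z∈) → qs z z∈ }

module Substitution {K : ℕ} (χ : Fin K → List (Fin K)) where

  -- The total g-weight of the word χ ^ k (b), without forming that word.
  weight : (Fin K → ℕ) → ℕ → Fin K → ℕ
  weight g zero    b = g b
  weight g (suc k) b = sum (map (weight g k) (χ b))

  data Path : ℕ → Fin K → Fin K → Set where
    []  : ∀ {b} → Path 0 b b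
    _∷_ : ∀ {k b x c} → x ∈ χ b → Path k x c → Path (suc k) b c

  infixr 5 _++ᴾ_
  _++ᴾ_ : ∀ {j k a b c} → Path j a b → Path k b c → Path (j + k) a c
  []      ++ᴾ q = q
  (e ∷ p) ++ᴾ q = e ∷ (p ++ᴾ q)

  -- At least one step is required, so `Reach b b` means that b lies on a cycle.
  Reach : Fin K → Fin K → Set
  Reach b c = ∃[ k ] Path (suc k) b c

  reach-trans : ∀ {a b c} → Reach a b → Reach b c → Reach a c
  reach-trans (j , p) (k , q) = j + suc k , (p ++ᴾ q)

  -- Warshall's algorithm: a walk whose intermediate vertices lie in the given list.
  Via : List (Fin K) → Fin K → Fin K → Set
  Via []      a c = c ∈ χ a
  Via (x ∷ l) a c = Via l a c ⊎ (Via l a x × Via l x c)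

  via? : ∀ l a c → Dec (Via l a c)
  via? []      a c = DecMembership._∈?_ Fin._≟_ c (χ a)
  via? (x ∷ l) a c = via? l a c ⊎-dec (via? l a x ×-dec via? l x c)

  via⇒reach : ∀ l {a c} → Via l a c → Reach a c
  via⇒reach []      e              = 0 , e ∷ []
  via⇒reach (x ∷ l) (inj₁ v)       = via⇒reach l v
  via⇒reach (x ∷ l) (inj₂ (v , u)) = reach-trans (via⇒reach l v) (via⇒reach l u)

  via-edge : ∀ l {a c} → c ∈ χ a → Via l a c
  via-edge []      e = e
  via-edge (x ∷ l) e = inj₁ (via-edge l e)

  -- If both walks visit the head vertex y, everything between the first and the last visit is cut
  -- out; otherwise the join happens inside one leg.
  via-trans : ∀ l {a x c} → x ∈ l → Via l a x → Via l x c → Via l a c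
  via-trans (y ∷ l) (here refl) v u = inj₂ (last v , first u)
    where
    last : ∀ {a} → Via (y ∷ l) a y → Via l a y
    last (inj₁ v)       = v
    last (inj₂ (v , _)) = v
    first : ∀ {c} → Via (y ∷ l) y c → Via l y c
    first (inj₁ u)       = u
    first (inj₂ (_ , u)) = u
  via-trans (y ∷ l) (there x∈) (inj₁ v)        (inj₁ u)        = inj₁ (via-trans l x∈ v u)
  via-trans (y ∷ l) (there x∈) (inj₁ v)        (inj₂ (u , u′)) = inj₂ (via-trans l x∈ v u , u′)
  via-trans (y ∷ l) (there x∈) (inj₂ (v , v′)) (inj₁ u)        = inj₂ (v , via-trans l x∈ v′ u)
  via-trans (y ∷ l) (there x∈) (inj₂ (v , _))  (inj₂ (_ , u))  = inj₂ (v , u)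

  path⇒via : ∀ {k a c} → Path (suc k) a c → Via (allFin K) a c
  path⇒via (e ∷ [])            = via-edge (allFin K) e
  path⇒via (_∷_ {x = x} e p@(_ ∷ _)) = via-trans (allFin K) (∈-allFin x) (via-edge (allFin K) e) (path⇒via p)

  reach? : ∀ a c → Dec (Reach a c)
  reach? a c with via? (allFin K) a c
  ... | yes v = yes (via⇒reach (allFin K) v)
  ... | no ¬v = no λ (_ , p) → ¬v (path⇒via p)

  -- The order of strongly connected components. It is a strict partial order on a finite set, hence
  -- well-founded.
  _⊏_ : Fin K → Fin K → Set
  y ⊏ a = Reach a y × ¬ Reach y a

  ⊏-isStrictPartialOrder : IsStrictPartialOrder _≡_ _⊏_
  ⊏-isStrictPartialOrder = record
    { isEquivalence = isEquivalence
    ; irrefl        = λ { refl (r , ¬r) → ¬r r }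
    ; trans         = λ { (r , ¬r) (s , ¬s) → reach-trans s r , λ t → ¬r (reach-trans t s) }
    ; <-resp-≈      = (λ { refl p → p }) , (λ { refl p → p })
    }

  path-weight-≤ : ∀ g {k b c} → Path k b c → ∀ j → weight g j c ≤ weight g (k + j) b
  path-weight-≤ g []      j = ≤-refl
  path-weight-≤ g {suc k} (e ∷ p) j = ≤-trans (path-weight-≤ g p j) (∈⇒≤sum (weight g (k + j)) e)

  size : ℕ → Fin K → ℕ
  size = weight (λ _ → 1)

  Grows : Fin K → Set
  Grows b = ∃[ j ] ∃[ q ] ∀ i → 2 ^ i ≤ size (j + i * q) b

  grows-along : ∀ {k b c} → Path k b c → Grows c → Grows b
  grows-along {k} {b} p (j , q , h) = k + j , q , λ i →
    ≤-trans (h i) (≤-trans (path-weight-≤ _ p (j + i * q)) (≤-reflexive (cong (λ m → size m b) (sym (+-assoc k j (i * q))))))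

  -- Any cycle will do, not necessarily a shortest one; a letter on no cycle gets the neutral factor
  -- 1.
  cycleLength : Fin K → ℕ
  cycleLength b with reach? b b
  ... | yes (k , _) = suc k
  ... | no _        = 1

  period : ℕ
  period = product (map cycleLength (allFin K))

  cycleLength∣period : ∀ b → cycleLength b ∣ period
  cycleLength∣period b = ∈⇒∣product (∈-map⁺ cycleLength (∈-allFin b))

  -- The weight g is left free because lengths and matches must be handled for the same letter.
  Polynomial : Fin K → Set
  Polynomial b = ∀ g → QuasiPolynomial period (λ k → weight g k b)

  module _ (nonempty : ∀ b → 1 ≤ length (χ b)) where

    sum-map-mono : ∀ {f h : Fin K → ℕ} xs → (∀ x → f x ≤ h x) → sum (map f xs) ≤ sum (map h xs)
    sum-map-mono []       f≤h = z≤n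
    sum-map-mono (x ∷ xs) f≤h = +-mono-≤ (f≤h x) (sum-map-mono xs f≤h)

    sum-ones : ∀ (xs : List (Fin K)) → sum (map (λ _ → 1) xs) ≡ length xs
    sum-ones []       = refl
    sum-ones (_ ∷ xs) = cong suc (sum-ones xs)

    size-suc : ∀ k b → size k b ≤ size (suc k) b
    size-suc zero    b = ≤-trans (nonempty b) (≤-reflexive (sym (sum-ones (χ b))))
    size-suc (suc k) b = sum-map-mono (χ b) (size-suc k)

    size-mono : ∀ j k b → size k b ≤ size (j + k) b
    size-mono zero    k b = ≤-refl
    size-mono (suc j) k b = ≤-trans (size-mono j k b) (size-suc (j + k) b)

    -- Images are nonempty, so sizes never decrease and the two return paths, of lengths k and m,
    -- can both be padded to k + m. One round then yields two copies of a at the same time.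
    double-return : ∀ {i k m a b x y} → Path i a b → (e : x ∈ χ b) → Path k x a → y ∈ (χ b ─ e) → Path m y a → Grows a
    double-return {i} {k} {m} {a} {b} {x} {y} p e q e′ r = 0 , period′ , powers
      where
      period′ = i + suc (k + m)
      doubling : ∀ j → size j a + size j a ≤ size (period′ + j) a
      doubling j = begin
        size j a + size j a                      ≤⟨ +-mono-≤ (size-mono m j a) (size-mono k j a) ⟩
        size (m + j) a + size (k + j) a          ≤⟨ +-mono-≤ (path-weight-≤ _ q (m + j)) (path-weight-≤ _ r (k + j)) ⟩
        size (k + (m + j)) x + size (m + (k + j)) y
          ≡⟨ cong₂ (λ u v → size u x + size v y) (sym (+-assoc k m j)) (swap m k j) ⟩
        size (k + m + j) x + size (k + m + j) y  ≤⟨ ∈∈⇒≤sum (size (k + m + j)) e e′ ⟩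
        size (suc (k + m + j)) b                 ≤⟨ path-weight-≤ _ p (suc (k + m + j)) ⟩
        size (i + suc (k + m + j)) a             ≡⟨ cong (λ u → size u a) (+-assoc i (suc (k + m)) j) ⟨
        size (period′ + j) a                     ∎
        where
        open ≤-Reasoning
        swap : ∀ m k j → m + (k + j) ≡ k + m + j
        swap = solve-∀
      powers : ∀ n → 2 ^ n ≤ size (n * period′) a
      powers zero    = ≤-refl
      powers (suc n) = ≤-trans (+-mono-≤ (powers n) (≤-trans (≤-reflexive (+-identityʳ (2 ^ n))) (powers n))) (doubling (n * period′))

    -- What remains after following the cycle from b to a. The start b is separate from a so that
    -- the cycle can be unwound edge by edge.
    Rest : Fin K → Fin K → ℕ → Set
    Rest a b k = ∀ g → ∃[ t ] QuasiPolynomial period t × (∀ j → weight g (k + j) b ≡ weight g j a + t j)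

    sibling : ∀ {i k a b x} → (∀ y → y ⊏ a → Grows y ⊎ Polynomial y) → Path i a b → (e : x ∈ χ b) → Path k x a →
      ∀ y → y ∈ (χ b ─ e) → Grows a ⊎ Polynomial y
    sibling {i} {a = a} rec p e q y y∈ with reach? y a
    ... | yes (m , r) = inj₁ (double-return p e q y∈ r)
    ... | no ¬r = map₁ (grows-along a⇝y) (rec y ((i , subst (λ n → Path n a y) (+-comm i 1) a⇝y) , ¬r))
      where
      a⇝y : Path (i + 1) a y
      a⇝y = p ++ᴾ (∈-─⁻ e y∈ ∷ [])

    -- Following a cycle at a, every letter produced off the cycle either
    -- returns to a, which doubles a, or lies strictly below a.
    unwind : ∀ {i k a b} → (∀ y → y ⊏ a → Grows y ⊎ Polynomial y) → Path i a b → Path k b a → Grows a ⊎ Rest a b k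
    unwind rec p [] = inj₂ λ g → (λ _ → 0) , quasi-0 , λ j → sym (+-identityʳ _)
    unwind {i} {suc k} {a} {b} rec p (_∷_ {x = x} e q)
      with some-or-all (χ b ─ e) (sibling rec p e q) | unwind rec (p ++ᴾ (e ∷ [])) q
    ... | inj₁ (_ , _ , grows) | _          = inj₁ grows
    ... | inj₂ _               | inj₁ grows = inj₁ grows
    ... | inj₂ polys           | inj₂ rest  = inj₂ λ g → let t , qt , eq = rest g in
      (λ j → t j + sum (map (weight g (k + j)) (χ b ─ e))) ,
      quasi-+ qt (quasi-sum (λ y j → weight g (k + j) y) (χ b ─ e) (λ y y∈ → quasi-shift k (polys y y∈ g))) ,
      λ j → trans (sum-─ (weight g (k + j)) e) (trans (cong (_+ sum (map (weight g (k + j)) (χ b ─ e))) (eq j)) (+-assoc (weight g j a) (t j) _))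

    grows-or-polynomial : ∀ b → Grows b ⊎ Polynomial b
    grows-or-polynomial b = go b (spo-wellFounded ⊏-isStrictPartialOrder b)
      where
      go : ∀ a → Acc _⊏_ a → Grows a ⊎ Polynomial a
      -- Abstracting `reach? a a` also evaluates `cycleLength a`, so the divisibility concerns the
      -- very cycle that is followed.
      go a (acc below) with reach? a a | cycleLength∣period a
      ... | yes (k , cycle) | k∣N with unwind (λ y y⊏a → go y (below y⊏a)) [] cycle
      ...   | inj₁ grows = inj₁ grows
      ...   | inj₂ rest  = inj₂ λ g → let t , qt , eq = rest g in quasi-antidifference (suc k) k∣N eq qt
      go a (acc below) | no ¬r | _ with some-or-all (χ a) (λ y y∈ →
        go y (below ((0 , y∈ ∷ []) , λ (k , q) → ¬r (suc k , y∈ ∷ q))))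
      ...   | inj₁ (y , y∈ , grows) = inj₁ (grows-along (y∈ ∷ []) grows)
      ...   | inj₂ polys = inj₂ λ g → quasi-unshift (quasi-sum (λ y k → weight g k y) (χ a) (λ y y∈ → polys y y∈ g))

-- Fixed points of morphisms and their windows

Σ< : (ℕ → ℕ) → ℕ → ℕ
Σ< f zero    = 0
Σ< f (suc n) = Σ< f n + f n

Σ<-+ : ∀ f m n → Σ< f (m + n) ≡ Σ< f m + Σ< (λ j → f (m + j)) n
Σ<-+ f m zero    = trans (cong (Σ< f) (+-identityʳ m)) (sym (+-identityʳ _))
Σ<-+ f m (suc n) = trans (cong (Σ< f) (+-suc m n))
  (trans (cong (_+ f (m + n)) (Σ<-+ f m n)) (+-assoc (Σ< f m) _ (f (m + n))))

Σ<-cong : ∀ {f g} n → (∀ i → i < n → f i ≡ g i) → Σ< f n ≡ Σ< g n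
Σ<-cong zero    f≡g = refl
Σ<-cong (suc n) f≡g = cong₂ _+_ (Σ<-cong n (λ i i<n → f≡g i (m≤n⇒m≤1+n i<n))) (f≡g n ≤-refl)

Σ<-≤1 : ∀ {f} n → (∀ i → f i ≤ 1) → Σ< f n ≤ n
Σ<-≤1 zero    f≤1 = z≤n
Σ<-≤1 (suc n) f≤1 = ≤-trans (+-mono-≤ (Σ<-≤1 n f≤1) (f≤1 n)) (≤-reflexive (+-comm n 1))

Σ<-suc : ∀ f n → Σ< f (suc n) ≡ f 0 + Σ< (f ∘ suc) n
Σ<-suc f n = Σ<-+ f 1 n

sum-applyUpTo : ∀ {B : Set} (f : B → ℕ) h n → sum (map f (applyUpTo h n)) ≡ Σ< (f ∘ h) n
sum-applyUpTo f h zero    = refl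
sum-applyUpTo f h (suc n) = trans (cong (f (h 0) +_) (sum-applyUpTo f (h ∘ suc) n)) (sym (Σ<-suc (f ∘ h) n))

indicator : ∀ {P : Set} → Dec P → ℕ
indicator (yes _) = 1
indicator (no _)  = 0

indicator-≤1 : ∀ {P : Set} (P? : Dec P) → indicator P? ≤ 1
indicator-≤1 (yes _) = ≤-refl
indicator-≤1 (no _)  = z≤n

length-filter-upTo : ∀ {P : ℕ → Set} (P? : Decidable P) n → length (filter P? (upTo n)) ≡ Σ< (λ i → indicator (P? i)) n
length-filter-upTo P? zero = refl
length-filter-upTo P? (suc n) = begin
  length (filter P? (upTo (suc n)))                             ≡⟨ cong (length ∘ filter P?) (upTo-∷ʳ n) ⟨
  length (filter P? (upTo n ++ [ n ]))                          ≡⟨ cong length (filter-++ P? (upTo n) [ n ]) ⟩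
  length (filter P? (upTo n) ++ filter P? [ n ])                ≡⟨ length-++ (filter P? (upTo n)) ⟩
  length (filter P? (upTo n)) + length (filter P? [ n ])        ≡⟨ cong₂ _+_ (length-filter-upTo P? n) (last (P? n)) ⟩
  Σ< (λ i → indicator (P? i)) n + indicator (P? n)              ∎
  where
  open ≡-Reasoning
  last : ∀ d → length (filter P? [ n ]) ≡ indicator (P? n)
  last _ with P? n
  ... | yes _ = refl
  ... | no _  = refl

module _ {A : Set} where

  applyUpTo-cong : ∀ {f g : ℕ → A} n → (∀ i → i < n → f i ≡ g i) → applyUpTo f n ≡ applyUpTo g n
  applyUpTo-cong zero    f≡g = refl
  applyUpTo-cong (suc n) f≡g = cong₂ _∷_ (f≡g 0 (s≤s z≤n)) (applyUpTo-cong n (λ i i<n → f≡g (suc i) (s≤s i<n)))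

  applyUpTo-++ : ∀ (f : ℕ → A) m n → applyUpTo f (m + n) ≡ applyUpTo f m ++ applyUpTo (λ j → f (m + j)) n
  applyUpTo-++ f zero    n = refl
  applyUpTo-++ f (suc m) n = cong (f 0 ∷_) (applyUpTo-++ (f ∘ suc) m n)

  tabulate-toℕ : ∀ (f : ℕ → A) n → tabulate {n = n} (f ∘ toℕ) ≡ applyUpTo f n
  tabulate-toℕ f zero    = refl
  tabulate-toℕ f (suc n) = cong (f 0 ∷_) (tabulate-toℕ (f ∘ suc) n)

  nth : A → List A → ℕ → A
  nth d []       _       = d
  nth d (x ∷ xs) zero    = x
  nth d (x ∷ xs) (suc i) = nth d xs i

  nth-applyUpTo : ∀ d (f : ℕ → A) {n i} → i < n → nth d (applyUpTo f n) i ≡ f i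
  nth-applyUpTo d f {suc n} {zero}  _         = refl
  nth-applyUpTo d f {suc n} {suc i} (s≤s i<n) = nth-applyUpTo d (f ∘ suc) i<n

funToFin-cong : ∀ {m n} {f g : Fin m → Fin n} → (∀ i → f i ≡ g i) → funToFin f ≡ funToFin g
funToFin-cong {zero}  f≡g = refl
funToFin-cong {suc m} f≡g = cong₂ combine (f≡g zero) (funToFin-cong (f≡g ∘ suc))

module _ {A : Set} (w : InfiniteWord A) where

  slice-++ : ∀ i m n → slice w i (m + n) ≡ slice w i m ++ slice w (i + m) n
  slice-++ i m n = trans (applyUpTo-++ (λ j → w (i + j)) m n)
    (cong (slice w i m ++_) (applyUpTo-cong n (λ j _ → cong w (sym (+-assoc i m j)))))

  length-slice : ∀ i n → length (slice w i n) ≡ n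
  length-slice i n = length-applyUpTo (λ j → w (i + j)) n

  -- These properties pass to iterates, so everything derived from them holds for every φ ^ k. The
  -- image of the i-th letter occupies the positions from `L i` up to but excluding `L (suc i)`.
  record Fixes (ψ : List A → List A) : Set where
    field
      ψ-++       : ∀ xs ys → ψ (xs ++ ys) ≡ ψ xs ++ ψ ys
      ψ-[]       : ψ [] ≡ []
      nonerasing : ∀ a → 1 ≤ length (ψ [ a ])
      ψ-prefix   : ∀ n → ψ (slice w 0 n) ≡ slice w 0 (length (ψ (slice w 0 n)))

    L : ℕ → ℕ
    L n = length (ψ (slice w 0 n))

    L0≡0 : L 0 ≡ 0
    L0≡0 = cong length ψ-[]

    L-+ : ∀ i m → L (i + m) ≡ L i + length (ψ (slice w i m))
    L-+ i m = trans (cong (length ∘ ψ) (slice-++ 0 i m))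
      (trans (cong length (ψ-++ (slice w 0 i) (slice w i m))) (length-++ (ψ (slice w 0 i))))

    image : ℕ → ℕ
    image i = length (ψ [ w i ])

    L-suc : ∀ i → L (suc i) ≡ L i + image i
    L-suc i = trans (cong L (+-comm 1 i)) (trans (L-+ i 1) (cong (λ j → L i + length (ψ [ w j ])) (+-identityʳ i)))

    L-strict : ∀ i → L i < L (suc i)
    L-strict i = ≤-trans (m<m+n (L i) (nonerasing (w i))) (≤-reflexive (sym (L-suc i)))

    ψ-slice : ∀ i m → ψ (slice w i m) ≡ slice w (L i) (length (ψ (slice w i m)))
    ψ-slice i m = ++-cancelˡ (slice w 0 (L i)) _ _ (begin
      slice w 0 (L i) ++ ψ (slice w i m)                ≡⟨ cong (_++ ψ (slice w i m)) (ψ-prefix i) ⟨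
      ψ (slice w 0 i) ++ ψ (slice w i m)                ≡⟨ ψ-++ (slice w 0 i) (slice w i m) ⟨
      ψ (slice w 0 i ++ slice w i m)                    ≡⟨ cong ψ (slice-++ 0 i m) ⟨
      ψ (slice w 0 (i + m))                             ≡⟨ ψ-prefix (i + m) ⟩
      slice w 0 (L (i + m))                             ≡⟨ cong (slice w 0) (L-+ i m) ⟩
      slice w 0 (L i + length (ψ (slice w i m)))        ≡⟨ slice-++ 0 (L i) _ ⟩
      slice w 0 (L i) ++ slice w (L i) (length (ψ (slice w i m)))  ∎)
      where open ≡-Reasoning

    ψ-letter : ∀ i → ψ [ w i ] ≡ slice w (L i) (image i)
    ψ-letter i = subst (λ j → ψ [ w j ] ≡ slice w (L i) (length (ψ [ w j ]))) (+-identityʳ i) (ψ-slice i 1)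

    length-ψ-≥ : ∀ xs → length xs ≤ length (ψ xs)
    length-ψ-≥ []       = z≤n
    length-ψ-≥ (x ∷ xs) = ≤-trans (+-mono-≤ (nonerasing x) (length-ψ-≥ xs))
      (≤-reflexive (sym (trans (cong length (ψ-++ [ x ] xs)) (length-++ (ψ [ x ])))))

    Σ<-L : ∀ f n → Σ< (λ i → Σ< (λ j → f (L i + j)) (image i)) n ≡ Σ< f (L n)
    Σ<-L f zero    = cong (Σ< f) (sym L0≡0)
    Σ<-L f (suc n) = trans (cong (_+ Σ< (λ j → f (L n + j)) (image n)) (Σ<-L f n)) (trans (sym (Σ<-+ f (L n) (image n))) (cong (Σ< f) (sym (L-suc n))))

  open Fixes

  iterate-fixes : ∀ {φ} → Fixes φ → ∀ k → Fixes (λ xs → fold xs φ k)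
  iterate-fixes F zero = record
    { ψ-++ = λ _ _ → refl ; ψ-[] = refl ; nonerasing = λ _ → ≤-refl
    ; ψ-prefix = λ n → cong (slice w 0) (sym (length-slice 0 n)) }
  iterate-fixes {φ} F (suc k) = let G = iterate-fixes F k in record
    { ψ-++       = λ xs ys → trans (cong φ (ψ-++ G xs ys)) (ψ-++ F _ _)
    ; ψ-[]       = trans (cong φ (ψ-[] G)) (ψ-[] F)
    ; nonerasing = λ a → ≤-trans (nonerasing G a) (length-ψ-≥ F _)
    ; ψ-prefix   = λ n → subst (λ xs → φ xs ≡ slice w 0 (length (φ xs))) (sym (ψ-prefix G n)) (ψ-prefix F (L G n)) }

  L-iterate : ∀ {φ} (F : Fixes φ) k n → L (iterate-fixes F k) n ≡ fold n (L F) k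
  L-iterate F zero    n = length-slice 0 n
  L-iterate {φ} F (suc k) n = trans (cong (length ∘ φ) (ψ-prefix (iterate-fixes F k) n)) (cong (L F) (L-iterate F k n))

  -- The finitely many length-ℓ windows of w, coded by Fin (m ^ ℓ), again form
  -- a fixed point of a substitution χ: the windows starting inside φ [ w i ]
  -- are determined by the window at i, because φ is non-erasing.
  module Windows {m : ℕ} (A↔Fin : A ↔ Fin m) {φ : List A → List A} (F : Fixes φ) (l : ℕ) where

    open Inverse A↔Fin using () renaming (to to code; from to decode; strictlyInverseʳ to decode-code)

    ℓ : ℕ
    ℓ = suc l

    window : (ℕ → A) → Fin (m ^ ℓ)
    window f = funToFin {ℓ} (λ t → code (f (toℕ t)))

    window-cong : ∀ {f g} → (∀ t → t < ℓ → f t ≡ g t) → window f ≡ window g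
    window-cong f≡g = funToFin-cong (λ t → cong code (f≡g (toℕ t) (Fin.toℕ<n t)))

    letter : Fin (m ^ ℓ) → Fin ℓ → A
    letter x t = decode (finToFun {m} {ℓ} x t)

    word : Fin (m ^ ℓ) → List A
    word x = tabulate (letter x)

    χ : Fin (m ^ ℓ) → List (Fin (m ^ ℓ))
    χ x = applyUpTo (λ j → window (λ t → nth (letter x zero) (φ (word x)) (j + t))) (length (φ [ letter x zero ]))

    χ-nonempty : ∀ x → 1 ≤ length (χ x)
    χ-nonempty x = ≤-trans (nonerasing F (letter x zero)) (≤-reflexive (sym (length-applyUpTo _ _)))

    β : ℕ → Fin (m ^ ℓ)
    β i = window (λ t → w (i + t))

    letter-β : ∀ i t → letter (β i) t ≡ w (i + toℕ t)
    letter-β i t = trans (cong decode (Fin.finToFun-funToFin {ℓ} {m} (λ t → code (w (i + toℕ t))) t)) (decode-code _)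

    first-β : ∀ i → letter (β i) zero ≡ w i
    first-β i = trans (letter-β i zero) (cong w (+-identityʳ i))

    word-β : ∀ i → word (β i) ≡ slice w i ℓ
    word-β i = trans (tabulate-cong (letter-β i)) (tabulate-toℕ (λ t → w (i + t)) ℓ)

    χ-β : ∀ i → χ (β i) ≡ applyUpTo (λ j → β (L F i + j)) (image F i)
    χ-β i = trans (cong (applyUpTo _) (cong (λ a → length (φ [ a ])) (first-β i)))
      (applyUpTo-cong (image F i) (λ j j<r → window-cong (λ t t<ℓ → begin
        nth d (φ (word (β i))) (j + t)               ≡⟨ cong (λ xs → nth d (φ xs) (j + t)) (word-β i) ⟩
        nth d (φ (slice w i ℓ)) (j + t)              ≡⟨ cong (λ xs → nth d xs (j + t)) (ψ-slice F i ℓ) ⟩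
        nth d (slice w (L F i) M) (j + t)
          -- The default of `nth` is never reached: each of the l letters after the first has a
          -- nonempty image, so the image of the window extends at least l letters beyond the first
          -- block.
          ≡⟨ nth-applyUpTo d (λ s → w (L F i + s)) (<-≤-trans (+-mono-<-≤ j<r (s≤s⁻¹ t<ℓ)) long) ⟩
        w (L F i + (j + t))                          ≡⟨ cong w (+-assoc (L F i) j t) ⟨
        w (L F i + j + t)                            ∎)))
      where
      open ≡-Reasoning
      d = letter (β i) zero
      M = length (φ (slice w i ℓ))
      split : M ≡ image F i + length (φ (slice w (i + 1) l))
      split = trans (cong (length ∘ φ) (slice-++ i 1 l)) (trans (cong length (ψ-++ F (slice w i 1) (slice w (i + 1) l)))
        (trans (length-++ (φ (slice w i 1))) (cong (λ j → length (φ [ w j ]) + length (φ (slice w (i + 1) l))) (+-identityʳ i))))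
      long : image F i + l ≤ M
      long = ≤-trans (+-monoʳ-≤ (image F i) (≤-trans (≤-reflexive (sym (length-slice (i + 1) l))) (length-ψ-≥ F (slice w (i + 1) l))))
        (≤-reflexive (sym split))

    open Substitution χ

    -- By `χ-β`, applying χ to the first n windows lists the first `L F n` windows, so iterating χ
    -- moves along the same prefix lengths as φ.
    Σ<-weight : ∀ g k n → Σ< (λ i → weight g k (β i)) n ≡ Σ< (λ i → g (β i)) (fold n (L F) k)
    Σ<-weight g zero    n = refl
    Σ<-weight g (suc k) n = begin
      Σ< (λ i → sum (map (weight g k) (χ (β i)))) n
        ≡⟨ Σ<-cong n (λ i _ → trans (cong (sum ∘ map (weight g k)) (χ-β i)) (sum-applyUpTo (weight g k) _ (image F i))) ⟩
      Σ< (λ i → Σ< (λ j → weight g k (β (L F i + j))) (image F i)) n          ≡⟨ Σ<-L F (λ i → weight g k (β i)) n ⟩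
      Σ< (λ i → weight g k (β i)) (L F n)                                     ≡⟨ Σ<-weight g k (L F n) ⟩
      Σ< (λ i → g (β i)) (fold (L F n) (L F) k)
        ≡⟨ cong (Σ< (λ i → g (β i))) (trans (sym (fold-+ n (L F) k)) (cong (fold n (L F)) (+-comm k 1))) ⟩
      Σ< (λ i → g (β i)) (L F (fold n (L F) k))                               ∎
      where open ≡-Reasoning

    weight-β : ∀ g k → weight g k (β 0) ≡ Σ< (λ i → g (β i)) (fold 1 (L F) k)
    weight-β g k = Σ<-weight g k 1

-- Two criteria for convergence

cauchy-≗ : ∀ {x y} → (∀ n → x n ≡ y n) → Cauchy x → Cauchy y
cauchy-≗ x≗y c e with c e
... | N , h = N , λ m n N≤m N≤n → subst₂ (λ a b → e * (a * m) ≤ e * (b * n) + m * n) (x≗y n) (x≗y m) (h m n N≤m N≤n)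

cauchy-0 : Cauchy (λ _ → 0)
cauchy-0 e = 0 , λ m n _ _ → ≤-trans (≤-reflexive (*-zeroʳ e)) z≤n

cauchy-+ : ∀ {x y} → Cauchy x → Cauchy y → Cauchy (λ n → x n + y n)
cauchy-+ {x} {y} c d e with c (2 * e) | d (2 * e)
... | M , h | N , k = M ⊔ N , λ m n p q → *-cancelˡ-≤ 2 (begin
  2 * (e * ((x n + y n) * m))                                          ≡⟨ left e (x n) (y n) m ⟩
  2 * e * (x n * m) + 2 * e * (y n * m)
    ≤⟨ +-mono-≤ (h m n (m⊔n≤o⇒m≤o M N p) (m⊔n≤o⇒m≤o M N q)) (k m n (m⊔n≤o⇒n≤o M N p) (m⊔n≤o⇒n≤o M N q)) ⟩
  (2 * e * (x m * n) + m * n) + (2 * e * (y m * n) + m * n)            ≡⟨ right e (x m) (y m) m n ⟩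
  2 * (e * ((x m + y m) * n) + m * n)                                  ∎)
  where
  open ≤-Reasoning
  left : ∀ e a b m → 2 * (e * ((a + b) * m)) ≡ 2 * e * (a * m) + 2 * e * (b * m)
  left = solve-∀
  right : ∀ e a b m n → (2 * e * (a * n) + m * n) + (2 * e * (b * n) + m * n) ≡ 2 * (e * ((a + b) * n) + m * n)
  right = solve-∀

cauchy-* : ∀ {x} c → Cauchy x → Cauchy (λ n → c * x n)
cauchy-* {x} c d e with d (e * c)
... | N , h = N , λ m n p q → subst₂ (λ a b → a ≤ b + m * n) (assoc′ e c (x n) m) (assoc′ e c (x m) n) (h m n p q)
  where
  assoc′ : ∀ e c a m → e * c * (a * m) ≡ e * (c * a * m)
  assoc′ = solve-∀

locate : ∀ (f : ℕ → ℕ) → (∀ j → j ≤ f j) → ∀ {J n} → f J ≤ n → ∃[ j ] J ≤ j × f j ≤ n × n < f (suc j)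
locate f j≤f {J} {n} = go (suc n) J ≤-refl (≤-trans (m≤n+m (suc n) J) (j≤f (J + suc n)))
  where
  go : ∀ fuel j → J ≤ j → n < f (j + fuel) → f j ≤ n → ∃[ j ] J ≤ j × f j ≤ n × n < f (suc j)
  go zero j J≤j n< f≤n = ⊥-elim (<⇒≱ (subst (λ i → n < f i) (+-identityʳ j) n<) f≤n)
  go (suc fuel) j J≤j n< f≤n with suc n ≤? f (suc j)
  ... | yes n<f = j , J≤j , f≤n , n<f
  ... | no n≮f  = go fuel (suc j) (m≤n⇒m≤1+n J≤j) (subst (λ i → n < f i) (+-suc j fuel) n<) (≮⇒≥ n≮f)

Σ<-mono : ∀ f {m n} → m ≤ n → Σ< f m ≤ Σ< f n
Σ<-mono f {m} {n} m≤n = subst (λ k → Σ< f m ≤ Σ< f k) (m+[n∸m]≡n m≤n)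
  (≤-trans (m≤m+n (Σ< f m) _) (≤-reflexive (sym (Σ<-+ f m (n ∸ m)))))

Σ<-lipschitz : ∀ {f} → (∀ i → f i ≤ 1) → ∀ {n} m k → n ≤ m + k → Σ< f n ≤ Σ< f m + k
Σ<-lipschitz {f} f≤1 m k n≤m+k = ≤-trans (Σ<-mono f n≤m+k)
  (≤-trans (≤-reflexive (Σ<-+ f m k)) (+-monoʳ-≤ (Σ< f m) (Σ<-≤1 k (λ i → f≤1 (m + i)))))

module _ {I : ℕ → ℕ} (I≤1 : ∀ i → I i ≤ 1) where

  private
    X : ℕ → ℕ
    X = Σ< I

  -- The values y j cut ℕ into intervals too short, relative to y j, to change the ratio.
  ratio⇒cauchy : ∀ {p q} (y z : ℕ → ℕ) → (∀ j → y (suc j) ≡ y j + z j) → z ≪ y → (∀ j → j ≤ y j) →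
    HasRatio (X ∘ y) y p (suc q) → Cauchy X
  ratio⇒cauchy {p} {q} y z Δy z≪y j≤y xy e = y J , λ m n yJ≤m yJ≤n →
    *-cancelˡ-≤ d (≤-trans (*-cancelˡ-≤ (2 * a) (begin
      2 * a * (d * (e * (X n * m)))             ≡⟨ lemma₁ e a d (X n) m ⟩
      c * (d * X n) * m                         ≤⟨ *-monoˡ-≤ m (upper (near n yJ≤n)) ⟩
      (c * (p * n) + a * n) * m                 ≡⟨ lemma₂ c p n a m ⟩
      c * (p * m) * n + a * (m * n)             ≤⟨ +-monoˡ-≤ (a * (m * n)) (*-monoˡ-≤ n (lower (near m yJ≤m))) ⟩
      (c * (d * X m) + a * m) * n + a * (m * n) ≡⟨ lemma₃ e a d (X m) m n ⟩
      2 * a * (d * (e * (X m * n)) + m * n)     ∎))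
    (≤-trans (+-monoʳ-≤ (d * (e * (X m * n))) (m≤m+n (m * n) (q * (m * n))))
      (≤-reflexive (sym (*-distribˡ-+ d (e * (X m * n)) (m * n))))))
    where
    open ≤-Reasoning
    d = suc q
    -- Each of the two estimates errs by one y j from the ratio and by d or p times y j from the
    -- interval, at most `a` times y j in all. The factor `2 * a` in `c` pays for both.
    a = suc (p + d)
    c = e * (2 * a)
    J = proj₁ (xy c) ⊔ proj₁ (z≪y c)
    lemma₁ : ∀ e a d x m → 2 * a * (d * (e * (x * m))) ≡ e * (2 * a) * (d * x) * m
    lemma₁ = solve-∀
    lemma₂ : ∀ c p n a m → (c * (p * n) + a * n) * m ≡ c * (p * m) * n + a * (m * n)
    lemma₂ = solve-∀
    lemma₃ : ∀ e a d x m n → (e * (2 * a) * (d * x) + a * m) * n + a * (m * n) ≡ 2 * a * (d * (e * (x * n)) + m * n)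
    lemma₃ = solve-∀
    near : ∀ n → y J ≤ n → ∃[ j ] J ≤ j × y j ≤ n × n < y (suc j)
    near n = locate y j≤y
    error : ∀ {n j} k → k ≤ p + d → y j ≤ n → y j + k * y j ≤ a * n
    error k k≤ y≤n = *-mono-≤ (s≤s k≤) y≤n
    expand : ∀ c d x z → c * (d * (x + z)) ≡ c * (d * x) + d * (c * z)
    expand = solve-∀
    upper : ∀ {n} → (∃[ j ] J ≤ j × y j ≤ n × n < y (suc j)) → c * (d * X n) ≤ c * (p * n) + a * n
    upper {n} (j , J≤j , y≤n , n<y) = begin
      c * (d * X n)
        ≤⟨ *-monoʳ-≤ c (*-monoʳ-≤ d (Σ<-lipschitz I≤1 (y j) (z j) (≤-trans (<⇒≤ n<y) (≤-reflexive (Δy j))))) ⟩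
      c * (d * (X (y j) + z j))                      ≡⟨ expand c d (X (y j)) (z j) ⟩
      c * (d * X (y j)) + d * (c * z j)
        ≤⟨ +-mono-≤ (proj₁ (proj₂ (xy c) j (m⊔n≤o⇒m≤o _ _ J≤j))) (*-monoʳ-≤ d (proj₂ (z≪y c) j (m⊔n≤o⇒n≤o (proj₁ (xy c)) _ J≤j))) ⟩
      (c * (p * y j) + y j) + d * y j                ≡⟨ +-assoc (c * (p * y j)) (y j) (d * y j) ⟩
      c * (p * y j) + (y j + d * y j)
        ≤⟨ +-mono-≤ (*-monoʳ-≤ c (*-monoʳ-≤ p y≤n)) (error d (m≤n+m d p) y≤n) ⟩
      c * (p * n) + a * n                            ∎
    lower : ∀ {n} → (∃[ j ] J ≤ j × y j ≤ n × n < y (suc j)) → c * (p * n) ≤ c * (d * X n) + a * n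
    lower {n} (j , J≤j , y≤n , n<y) = begin
      c * (p * n)
        ≤⟨ *-monoʳ-≤ c (*-monoʳ-≤ p (≤-trans (<⇒≤ n<y) (≤-reflexive (Δy j)))) ⟩
      c * (p * (y j + z j))                          ≡⟨ expand c p (y j) (z j) ⟩
      c * (p * y j) + p * (c * z j)
        ≤⟨ +-mono-≤ (proj₂ (proj₂ (xy c) j (m⊔n≤o⇒m≤o _ _ J≤j))) (*-monoʳ-≤ p (proj₂ (z≪y c) j (m⊔n≤o⇒n≤o (proj₁ (xy c)) _ J≤j))) ⟩
      (c * (d * X (y j)) + y j) + p * y j            ≡⟨ +-assoc (c * (d * X (y j))) (y j) (p * y j) ⟩
      c * (d * X (y j)) + (y j + p * y j)
        ≤⟨ +-mono-≤ (*-monoʳ-≤ c (*-monoʳ-≤ d (Σ<-mono I y≤n))) (error p (m≤m+n p d) y≤n) ⟩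
      c * (d * X n) + a * n                          ∎

  -- What the exponential case needs of an iterate: V counts matches inside blocks, `ℓ` bounds those
  -- lost per block, and C is the stretch. The gap D may depend on C, since it is only compared with
  -- large i.
  record Blocks (ℓ C : ℕ) : Set where
    field
      L V      : ℕ → ℕ
      L-cauchy : Cauchy L
      V-cauchy : Cauchy V
      i≤L      : ∀ i → i ≤ L i
      D        : ℕ
      L-gap    : ∀ i → L (suc i) ≤ L i + D
      V≤X      : ∀ i → V i ≤ X (L i)
      X≤V      : ∀ i → X (L i) ≤ V i + ℓ * i
      growth   : Eventually λ i → C * i ≤ L i

  -- Here X n / n is close to V i / L i for the block i containing n. Lost matches and the
  -- unfinished block cost at most (ℓ + 1) * i, a small part of L i because C * i ≤ L i.
  blocks⇒cauchy : ∀ {ℓ} → (∀ C → Blocks ℓ C) → Cauchy X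
  blocks⇒cauchy blocks zero = 0 , λ _ _ _ _ → z≤n
  blocks⇒cauchy {ℓ} blocks (suc e) = L I₀ , λ m n p q → bound (near m p) (near n q)
    where
    a C : ℕ
    -- The errors, in units of L i * L j: 3 from `quotient`, 1 from replacing m by L j + j, and 2 *
    -- (ℓ + 1) from lost matches and the unfinished block.
    a = suc (5 + 2 * ℓ)
    C = a * suc e
    open Blocks (blocks C)
    I₀ I₁ I₂ I₃ : ℕ
    I₁ = proj₁ (L-cauchy C)
    I₂ = proj₁ (V-cauchy C)
    I₃ = proj₁ growth
    I₀ = (I₁ ⊔ I₂) ⊔ (I₃ ⊔ suc D)
    Near : ℕ → Set
    Near n = ∃[ i ] I₀ ≤ i × L i ≤ n × n < L (suc i)
    near : ∀ n → L I₀ ≤ n → Near n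
    near n = locate L i≤L
    grown : ∀ {i} → I₀ ≤ i → C * i ≤ L i
    grown I≤i = proj₂ growth _ (m⊔n≤o⇒m≤o I₃ _ (m⊔n≤o⇒n≤o (I₁ ⊔ I₂) _ I≤i))
    D<i : ∀ {i} → I₀ ≤ i → D < i
    D<i I≤i = m⊔n≤o⇒n≤o I₃ _ (m⊔n≤o⇒n≤o (I₁ ⊔ I₂) _ I≤i)
    V≤L : ∀ i → V i ≤ L i
    V≤L i = ≤-trans (V≤X i) (Σ<-≤1 (L i) I≤1)
    -- V i / L i is (V i / i) / (L i / i): the two Cauchy inequalities are multiplied and i * j * C
    -- is cancelled. Each of the three error terms is at most C * (L i * L j).
    quotient : ∀ i j → I₀ ≤ i → I₀ ≤ j → C * (V i * L j) ≤ C * (V j * L i) + 3 * (L i * L j)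
    quotient i j I≤i I≤j = *-cancelˡ-≤ (i * j * C) {{ijC≢0}} (begin
      i * j * C * (C * (V i * L j))                                    ≡⟨ regroup i j C (V i) (L j) ⟩
      C * (V i * j) * (C * (L j * i))
        ≤⟨ *-mono-≤ (proj₂ (V-cauchy C) j i (I₂≤ I≤j) (I₂≤ I≤i)) (proj₂ (L-cauchy C) i j (I₁≤ I≤i) (I₁≤ I≤j)) ⟩
      (C * (V j * i) + j * i) * (C * (L i * j) + i * j)                ≡⟨ multiply i j C (V j) (L i) ⟩
      i * j * (C * (C * (V j * L i)) + C * (V j * i + j * L i) + i * j)
        ≤⟨ *-monoʳ-≤ (i * j) (+-mono-≤ (+-monoʳ-≤ (C * (C * (V j * L i))) (*-monoʳ-≤ C (+-mono-≤ (*-mono-≤ (V≤L j) (i≤L i)) (*-monoˡ-≤ (L i) (i≤L j))))) (≤-trans (*-mono-≤ (i≤L i) (i≤L j)) (m≤m+n _ _))) ⟩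
      i * j * (C * (C * (V j * L i)) + C * (L j * L i + L j * L i) + C * (L i * L j))
        ≡⟨ collect i j C (V j) (L i) (L j) ⟩
      i * j * C * (C * (V j * L i) + 3 * (L i * L j))                  ∎)
      where
      open ≤-Reasoning
      i≢0 : ∀ {i} → I₀ ≤ i → NonZero i
      i≢0 I≤i = >-nonZero (<-≤-trans (s≤s z≤n) (D<i I≤i))
      ijC≢0 : NonZero (i * j * C)
      ijC≢0 = m*n≢0 (i * j) C {{m*n≢0 i j {{i≢0 I≤i}} {{i≢0 I≤j}}}}
      I₁≤ : ∀ {i} → I₀ ≤ i → I₁ ≤ i
      I₁≤ I≤i = m⊔n≤o⇒m≤o I₁ I₂ (m⊔n≤o⇒m≤o (I₁ ⊔ I₂) _ I≤i)
      I₂≤ : ∀ {i} → I₀ ≤ i → I₂ ≤ i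
      I₂≤ I≤i = m⊔n≤o⇒n≤o I₁ I₂ (m⊔n≤o⇒m≤o (I₁ ⊔ I₂) _ I≤i)
      regroup : ∀ i j c v l → i * j * c * (c * (v * l)) ≡ c * (v * j) * (c * (l * i))
      regroup = solve-∀
      multiply : ∀ i j c v l → (c * (v * i) + j * i) * (c * (l * j) + i * j) ≡ i * j * (c * (c * (v * l)) + c * (v * i + j * l) + i * j)
      multiply = solve-∀
      collect : ∀ i j c v l l′ → i * j * (c * (c * (v * l)) + c * (l′ * l + l′ * l) + c * (l * l′)) ≡ i * j * c * (c * (v * l) + 3 * (l * l′))
      collect = solve-∀
    bound : ∀ {m n} → Near m → Near n → suc e * (X n * m) ≤ suc e * (X m * n) + m * n
    bound {m} {n} (j , I≤j , L≤m , m<L) (i , I≤i , L≤n , n<L) = *-cancelˡ-≤ a (begin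
      a * (suc e * (X n * m))                                 ≡⟨ *-assoc a (suc e) (X n * m) ⟨
      C * (X n * m)                                           ≤⟨ *-monoʳ-≤ C (*-mono-≤ Xn≤ m≤) ⟩
      C * ((V i + (ℓ * i + i)) * (L j + j))                   ≡⟨ expand C (V i) ℓ i (L j) j ⟩
      C * (V i * L j) + (V i * (C * j) + suc ℓ * (C * i * L j + C * i * j))
        ≤⟨ +-mono-≤ (quotient i j I≤i I≤j) (+-mono-≤ (*-mono-≤ (V≤L i) (grown I≤j)) (*-monoʳ-≤ (suc ℓ) (+-mono-≤ (*-monoˡ-≤ (L j) (grown I≤i)) (*-mono-≤ (grown I≤i) (i≤L j))))) ⟩
      (C * (V j * L i) + 3 * (L i * L j)) + (L i * L j + suc ℓ * (L i * L j + L i * L j))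
        ≡⟨ collect a e (V j) ℓ (L i) (L j) ⟩
      C * (V j * L i) + a * (L j * L i)
        ≤⟨ +-mono-≤ (*-monoʳ-≤ C (*-mono-≤ (≤-trans (V≤X j) (Σ<-mono I L≤m)) L≤n)) (*-monoʳ-≤ a (*-mono-≤ L≤m L≤n)) ⟩
      C * (X m * n) + a * (m * n)                             ≡⟨ cong (_+ a * (m * n)) (*-assoc a (suc e) (X m * n)) ⟩
      a * (suc e * (X m * n)) + a * (m * n)                   ≡⟨ *-distribˡ-+ a (suc e * (X m * n)) (m * n) ⟨
      a * (suc e * (X m * n) + m * n)                         ∎)
      where
      open ≤-Reasoning
      Xn≤ : X n ≤ V i + (ℓ * i + i)
      Xn≤ = ≤-trans (Σ<-lipschitz I≤1 (L i) D (≤-trans (<⇒≤ n<L) (L-gap i)))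
        (≤-trans (+-mono-≤ (X≤V i) (<⇒≤ (D<i I≤i))) (≤-reflexive (+-assoc (V i) (ℓ * i) i)))
      m≤ : m ≤ L j + j
      m≤ = ≤-trans (<⇒≤ m<L) (≤-trans (L-gap j) (+-monoʳ-≤ (L j) (<⇒≤ (D<i I≤j))))
      expand : ∀ c v ℓ i l j → c * ((v + (ℓ * i + i)) * (l + j)) ≡ c * (v * l) + (v * (c * j) + (1 + ℓ) * (c * i * l + c * i * j))
      expand = solve-∀
      collect : ∀ a e v ℓ l l′ → (a * (1 + e) * (v * l) + 3 * (l * l′)) + (l * l′ + (1 + ℓ) * (l * l′ + l * l′)) ≡ a * (1 + e) * (v * l) + (6 + 2 * ℓ) * (l′ * l)
      collect = solve-∀

n<2^n : ∀ n → n < 2 ^ n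
n<2^n zero    = ≤-refl
n<2^n (suc n) = ≤-trans (s≤s (n<2^n n)) (≤-trans (+-monoˡ-≤ (2 ^ n) (≤-trans (s≤s z≤n) (n<2^n n))) (+-monoʳ-≤ (2 ^ n) (m≤m+n (2 ^ n) 0)))

-- If the first step is slower than D, the hypothesis survives with y 1 in place of y 0 and one
-- factor D fewer; with no steps left it is absurd.
fast-step : ∀ D T (y : ℕ → ℕ) → D ^ T * y 0 < y T → ∃[ t ] D * y t ≤ y (suc t)
fast-step D zero    y h = ⊥-elim (<-irrefl (+-identityʳ (y 0)) h)
fast-step D (suc T) y h with D * y 0 ≤? y 1
... | yes fast = 0 , fast
... | no slow with fast-step D T (y ∘ suc) (≤-<-trans (≤-trans (*-monoʳ-≤ (D ^ T) (<⇒≤ (≰⇒> slow))) (≤-reflexive (swap (D ^ T) D (y 0)))) h)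
  where
  swap : ∀ p d a → p * (d * a) ≡ d * p * a
  swap = solve-∀
...   | t , fast = suc t , fast

-- Frequencies in pure morphic words

Σ<-* : ∀ c f n → Σ< (λ i → c * f i) n ≡ c * Σ< f n
Σ<-* c f zero    = sym (*-zeroʳ c)
Σ<-* c f (suc n) = trans (cong (_+ c * f n) (Σ<-* c f n)) (sym (*-distribˡ-+ c (Σ< f n) (f n)))

Σ<-distrib-+ : ∀ f g n → Σ< (λ i → f i + g i) n ≡ Σ< f n + Σ< g n
Σ<-distrib-+ f g zero    = refl
Σ<-distrib-+ f g (suc n) = trans (cong (_+ (f n + g n)) (Σ<-distrib-+ f g n)) (interchange (Σ< f n) (Σ< g n) (f n) (g n))
  where
  interchange : ∀ a b c d → (a + b) + (c + d) ≡ (a + c) + (b + d)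
  interchange = solve-∀

Σ<-mono-≤ : ∀ {f g} c n → (∀ i → f i ≤ g i + c) → Σ< f n ≤ Σ< g n + c * n
Σ<-mono-≤ c zero    h = z≤n
Σ<-mono-≤ {f} {g} c (suc n) h = ≤-trans (+-mono-≤ (Σ<-mono-≤ c n h) (h n)) (≤-reflexive (regroup (Σ< g n) (g n) c n))
  where
  regroup : ∀ a b c n → (a + c * n) + (b + c) ≡ (a + b) + c * (1 + n)
  regroup = solve-∀

Σ<-0 : ∀ {f} n → (∀ i → f i ≡ 0) → Σ< f n ≡ 0
Σ<-0 zero    f≡0 = refl
Σ<-0 (suc n) f≡0 = cong₂ _+_ (Σ<-0 n f≡0) (f≡0 n)

Σ<-1 : ∀ n → Σ< (λ _ → 1) n ≡ n
Σ<-1 zero    = refl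
Σ<-1 (suc n) = trans (+-comm (Σ< (λ _ → 1) n) 1) (cong suc (Σ<-1 n))

unless : ∀ {P : Set} → Dec P → ℕ → ℕ
unless (yes _) n = 0
unless (no _)  n = n

module _ {A : Set} where

  nonempty⇒1≤length : ∀ (xs : List A) → xs ≢ [] → 1 ≤ length xs
  nonempty⇒1≤length []      xs≢[] = ⊥-elim (xs≢[] refl)
  nonempty⇒1≤length (_ ∷ _) _     = s≤s z≤n

  take-length-++ : ∀ (xs ys : List A) → take (length xs) (xs ++ ys) ≡ xs
  take-length-++ []       ys = refl
  take-length-++ (x ∷ xs) ys = cong (x ∷_) (take-length-++ xs ys)

module _ {A : Set} (fin : Finite A) where

  private
    code = proj₂ fin
    open Inverse code using () renaming (to to toFin; from to fromFin; strictlyInverseʳ to fromFin-toFin)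

  _≟ᴬ_ : (x y : A) → Dec (x ≡ y)
  _≟ᴬ_ = finite⇒≟ fin

  _≟*_ : (xs ys : List A) → Dec (xs ≡ ys)
  _≟*_ = ≡-dec _≟ᴬ_

  letters : List A
  letters = map fromFin (allFin (proj₁ fin))

  ∈-letters : ∀ a → a ∈ letters
  ∈-letters a = subst (_∈ letters) (fromFin-toFin a) (∈-map⁺ fromFin (∈-allFin (toFin a)))

  match : InfiniteWord A → List A → ℕ → ℕ → ℕ
  match w v ℓ i = indicator (slice w i ℓ ≟* v)

  occurrences≡Σ< : ∀ w v {ℓ} → length v ≡ ℓ → ∀ n → occurrences fin w v n ≡ Σ< (match w v ℓ) n
  occurrences≡Σ< w v refl n = length-filter-upTo (λ i → slice w i (length v) ≟* v) n

  -- The sum is a combination of letter counts, peeled off one letter at a time. `rest` vanishes at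
  -- the peeled letter, so the remaining list still supports it.
  letter-sum-cauchy : ∀ (w : InfiniteWord A) → (∀ a → HasFrequency fin w [ a ]) → ∀ (g : A → ℕ) → Cauchy (Σ< (g ∘ w))
  letter-sum-cauchy w freq g = supported letters g λ x x∉ → ⊥-elim (x∉ (∈-letters x))
    where
    supported : ∀ as (g : A → ℕ) → (∀ x → x ∉ as → g x ≡ 0) → Cauchy (Σ< (g ∘ w))
    supported [] g g≡0 = cauchy-≗ (λ n → sym (Σ<-0 n (λ i → g≡0 (w i) λ ()))) cauchy-0
    supported (a ∷ as) g g≡0 = cauchy-≗ assemble
      (cauchy-+ {λ n → g a * occurrences fin w [ a ] n} {Σ< (rest ∘ w)}
        (cauchy-* {occurrences fin w [ a ]} (g a) (hasLimit⇒cauchy {occurrences fin w [ a ]} (freq a)))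
        (supported as rest rest≡0))
      where
      rest : A → ℕ
      rest x = unless (x ≟ᴬ a) (g x)
      rest≡0 : ∀ x → x ∉ as → rest x ≡ 0
      rest≡0 x x∉ = go (x ≟ᴬ a)
        where
        go : (d : Dec (x ≡ a)) → unless d (g x) ≡ 0
        go (yes _)  = refl
        go (no x≢a) = g≡0 x λ { (here x≡a) → x≢a x≡a ; (there x∈) → x∉ x∈ }
      split : ∀ i → g a * match w [ a ] 1 i + rest (w i) ≡ g (w i)
      split i = go (slice w i 1 ≟* [ a ]) (w i ≟ᴬ a)
        where
        go : (d : Dec (slice w i 1 ≡ [ a ])) (d′ : Dec (w i ≡ a)) → g a * indicator d + unless d′ (g (w i)) ≡ g (w i)
        go (yes _)  (yes wi≡a) = trans (+-identityʳ _) (trans (*-identityʳ (g a)) (cong g (sym wi≡a)))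
        go (no ≢a)  (yes wi≡a) = ⊥-elim (≢a (cong [_] (trans (cong w (+-identityʳ i)) wi≡a)))
        go (yes ≡a) (no wi≢a)  = ⊥-elim (wi≢a (trans (cong w (sym (+-identityʳ i))) (∷-injectiveˡ ≡a)))
        go (no _)   (no _)     = cong (_+ g (w i)) (*-zeroʳ (g a))
      assemble : ∀ n → g a * occurrences fin w [ a ] n + Σ< (rest ∘ w) n ≡ Σ< (g ∘ w) n
      assemble n = begin
        g a * occurrences fin w [ a ] n + Σ< (rest ∘ w) n
          ≡⟨ cong (λ k → g a * k + Σ< (rest ∘ w) n) (occurrences≡Σ< w [ a ] refl n) ⟩
        g a * Σ< (match w [ a ] 1) n + Σ< (rest ∘ w) n
          ≡⟨ cong (_+ Σ< (rest ∘ w) n) (Σ<-* (g a) (match w [ a ] 1) n) ⟨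
        Σ< (λ i → g a * match w [ a ] 1 i) n + Σ< (rest ∘ w) n
          ≡⟨ Σ<-distrib-+ (λ i → g a * match w [ a ] 1 i) (rest ∘ w) n ⟨
        Σ< (λ i → g a * match w [ a ] 1 i + rest (w i)) n           ≡⟨ Σ<-cong n (λ i _ → split i) ⟩
        Σ< (g ∘ w) n                                                ∎
        where open ≡-Reasoning

  module _ {w : InfiniteWord A} {φ : List A → List A} (F : Fixes w φ) where

    open Fixes F

    i≤L : ∀ i → i ≤ L i
    i≤L zero    = z≤n
    i≤L (suc i) = ≤-trans (s≤s (i≤L i)) (L-strict i)

    L≡Σ< : ∀ n → Σ< (λ i → length (φ [ w i ])) n ≡ L n
    L≡Σ< zero    = sym L0≡0
    L≡Σ< (suc n) = trans (cong (_+ image n) (L≡Σ< n)) (sym (L-suc n))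

    -- The range of j drops the last position at which v would still fit into φ [ a ].
    inside : ℕ → List A → A → ℕ
    inside ℓ v a = Σ< (λ j → indicator (applyUpTo (λ t → nth a (φ [ a ]) (j + t)) ℓ ≟* v)) (length (φ [ a ]) ∸ ℓ)

    module _ (ℓ : ℕ) (v : List A) where

      private
        block : ℕ → ℕ → ℕ
        block i n = Σ< (λ j → match w v ℓ (L i + j)) n

      inside≡ : ∀ i → inside ℓ v (w i) ≡ block i (image i ∸ ℓ)
      inside≡ i = Σ<-cong (image i ∸ ℓ) λ j j<r∸ℓ → cong (λ xs → indicator (xs ≟* v)) (applyUpTo-cong ℓ λ t t<ℓ → begin
        nth (w i) (φ [ w i ]) (j + t)                   ≡⟨ cong (λ xs → nth (w i) xs (j + t)) (ψ-letter i) ⟩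
        nth (w i) (slice w (L i) (image i)) (j + t)
          ≡⟨ nth-applyUpTo (w i) (λ s → w (L i + s)) (fits j t j<r∸ℓ t<ℓ) ⟩
        w (L i + (j + t))                               ≡⟨ cong w (+-assoc (L i) j t) ⟨
        w (L i + j + t)                                 ∎)
        where
        open ≡-Reasoning
        fits : ∀ j t → j < image i ∸ ℓ → t < ℓ → j + t < image i
        fits j t j< t<ℓ = <-≤-trans (+-monoʳ-< j t<ℓ) (m≤o∸n⇒m+n≤o j ℓ≤r (<⇒≤ j<))
          where
          ℓ≤r : ℓ ≤ image i
          ℓ≤r = <⇒≤ (m∸n≢0⇒n<m (m<n⇒n≢0 j<))

      inside-≤ : ∀ n → Σ< (inside ℓ v ∘ w) n ≤ Σ< (match w v ℓ) (L n)
      inside-≤ n = ≤-trans (Σ<-mono-≤ 0 n λ i → ≤-trans (≤-reflexive (inside≡ i))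
        (≤-trans (Σ<-mono _ (m∸n≤m (image i) ℓ)) (m≤m+n _ 0)))
        (≤-reflexive (trans (+-identityʳ _) (Σ<-L (match w v ℓ) n)))

      -- A block omits at most ℓ starting positions: its last ℓ, or all of them if it is shorter.
      ≤-inside : ∀ n → Σ< (match w v ℓ) (L n) ≤ Σ< (inside ℓ v ∘ w) n + ℓ * n
      ≤-inside n = ≤-trans (≤-reflexive (sym (Σ<-L (match w v ℓ) n))) (Σ<-mono-≤ ℓ n λ i →
        ≤-trans (Σ<-lipschitz (λ j → indicator-≤1 (slice w (L i + j) ℓ ≟* v)) (image i ∸ ℓ) ℓ
          (≤-trans (m≤n+m∸n (image i) ℓ) (≤-reflexive (+-comm ℓ _))))
        (≤-reflexive (cong (_+ ℓ) (sym (inside≡ i)))))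

  module _ {w : InfiniteWord A} (freq : ∀ a → HasFrequency fin w [ a ]) where

    fixes-L-cauchy : ∀ {φ} (F : Fixes w φ) → Cauchy (Fixes.L F)
    fixes-L-cauchy {φ} F = cauchy-≗ (L≡Σ< F) (letter-sum-cauchy w freq (λ a → length (φ [ a ])))

    fixes⇒blocks : ∀ {φ} (F : Fixes w φ) ℓ v C → Eventually (λ i → C * i ≤ Fixes.L F i) →
      Blocks (λ i → indicator-≤1 (slice w i ℓ ≟* v)) ℓ C
    fixes⇒blocks {φ} F ℓ v C growth = record
      { L = L ; V = Σ< (inside F ℓ v ∘ w)
      ; L-cauchy = fixes-L-cauchy F ; V-cauchy = letter-sum-cauchy w freq (inside F ℓ v)
      ; i≤L = i≤L F
      ; D = sum (map (λ a → length (φ [ a ])) letters)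
      ; L-gap = λ i → ≤-trans (≤-reflexive (L-suc i)) (+-monoʳ-≤ (L i) (∈⇒≤sum _ (∈-letters (w i))))
      ; V≤X = inside-≤ F ℓ v ; X≤V = ≤-inside F ℓ v
      ; growth = growth }
      where open Fixes F

  module _ {w : InfiniteWord A} {φ : List A → List A} (F : Fixes w φ) (2≤L1 : 2 ≤ Fixes.L F 1) where

    open Fixes F

    -- |φ ^ k (b)|, where b = w 0.
    prefixLength : ℕ → ℕ
    prefixLength k = fold 1 L k

    L-increases : ∀ n → 1 ≤ n → n < L n
    L-increases (suc zero)      _ = 2≤L1
    L-increases (suc (suc n)) _ = ≤-<-trans (L-increases (suc n) (s≤s z≤n)) (L-strict (suc n))

    k<prefixLength : ∀ k → k < prefixLength k
    k<prefixLength zero    = ≤-refl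
    k<prefixLength (suc k) = ≤-<-trans (k<prefixLength k) (L-increases _ (≤-trans (s≤s z≤n) (k<prefixLength k)))

    prefixLength-mono : ∀ j k → prefixLength k ≤ prefixLength (j + k)
    prefixLength-mono zero    k = ≤-refl
    prefixLength-mono (suc j) k = ≤-trans (prefixLength-mono j k) (i≤L F _)

    -- Exponential growth of the prefixes forces some, hence by convergence every, long prefix to be stretched by C.
    iterate-growth : (∀ k → Cauchy (Fixes.L (iterate-fixes w F k))) → ∀ j q → (∀ i → 2 ^ i ≤ prefixLength (j + i * q)) →
      ∀ C → ∃[ k ] Eventually λ i → C * i ≤ Fixes.L (iterate-fixes w F k) i
    iterate-growth cauchy j q exponential C = k , N , λ n N≤n →
      *-cancelˡ-≤ m {{>-nonZero (≤-<-trans z≤n N<m)}} (+-cancelʳ-≤ (n * m) _ _ (begin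
        m * (C * n) + n * m      ≡⟨ left m C n ⟩
        -- The stretch is `suc C` at m because passing from m to n with tolerance 1 loses one unit.
        suc C * m * n            ≤⟨ *-monoˡ-≤ n stretched ⟩
        Lᵏ m * n                 ≡⟨ *-identityˡ (Lᵏ m * n) ⟨
        1 * (Lᵏ m * n)           ≤⟨ proj₂ (cauchy k 1) n m N≤n (<⇒≤ N<m) ⟩
        1 * (Lᵏ n * m) + n * m   ≡⟨ cong (_+ n * m) (trans (*-identityˡ (Lᵏ n * m)) (*-comm (Lᵏ n) m)) ⟩
        m * Lᵏ n + n * m         ∎))
      where
      open ≤-Reasoning
      K k N T : ℕ
      -- Over T rounds the exponent T * K splits as (C + 1) * T + T: the first part beats (C + 1) ^
      -- T, and the second beats the initial value, since T is chosen as `y 0`.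
      K = suc (suc C)
      k = K * q
      Lᵏ : ℕ → ℕ
      Lᵏ = Fixes.L (iterate-fixes w F k)
      N = proj₁ (cauchy k 1)
      y : ℕ → ℕ
      -- The offset N places every y t beyond the Cauchy modulus.
      y t = prefixLength (N + (j + t * k))
      T = y 0
      left : ∀ m c n → m * (c * n) + n * m ≡ (1 + c) * m * n
      left = solve-∀
      fast : suc C ^ T * y 0 < y T
      fast = begin-strict
        suc C ^ T * T                     <⟨ *-monoʳ-< (suc C ^ T) {{m^n≢0 (suc C) T}} (n<2^n T) ⟩
        suc C ^ T * 2 ^ T                 ≤⟨ *-monoˡ-≤ (2 ^ T) (^-monoˡ-≤ T (<⇒≤ (n<2^n (suc C)))) ⟩
        (2 ^ suc C) ^ T * 2 ^ T           ≡⟨ cong (_* 2 ^ T) (^-*-assoc 2 (suc C) T) ⟩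
        2 ^ (suc C * T) * 2 ^ T           ≡⟨ ^-distribˡ-+-* 2 (suc C * T) T ⟨
        2 ^ (suc C * T + T)               ≡⟨ cong (2 ^_) (exponent C T) ⟩
        2 ^ (T * K)                       ≤⟨ exponential (T * K) ⟩
        prefixLength (j + T * K * q)      ≡⟨ cong (λ s → prefixLength (j + s)) (*-assoc T K q) ⟩
        prefixLength (j + T * k)          ≤⟨ prefixLength-mono N (j + T * k) ⟩
        y T                               ∎
        where
        exponent : ∀ c t → (1 + c) * t + t ≡ t * (2 + c)
        exponent = solve-∀
      step : ∃[ t ] suc C * y t ≤ y (suc t)
      step = fast-step (suc C) T y fast
      t m : ℕ
      t = proj₁ step
      m = y t
      N<m : N < m
      N<m = ≤-<-trans (m≤m+n N (j + t * k)) (k<prefixLength _)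
      stretched : suc C * m ≤ Lᵏ m
      stretched = ≤-trans (proj₂ step) (≤-reflexive (trans (cong prefixLength (shift N j t k))
        (trans (fold-+ 1 L k) (sym (L-iterate w F k m)))))
        where
        shift : ∀ n j t k → n + (j + (1 + t) * k) ≡ k + (n + (j + t * k))
        shift = solve-∀

    module _ (l : ℕ) (v : List A) where

      open Windows w (proj₂ fin) F l
      open Substitution χ

      private
        isMatch : Fin (proj₁ fin ^ ℓ) → ℕ
        isMatch x = indicator (word x ≟* v)
        X : ℕ → ℕ
        X = Σ< (match w v ℓ)

      size-β : ∀ k → size k (β 0) ≡ prefixLength k
      size-β k = trans (weight-β (λ _ → 1) k) (Σ<-1 _)

      matches-β : ∀ k → weight isMatch k (β 0) ≡ X (prefixLength k)
      matches-β k = trans (weight-β isMatch k) (Σ<-cong (prefixLength k) λ i _ → cong (λ xs → indicator (xs ≟* v)) (word-β i))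

      period≢0 : NonZero period
      period≢0 = product≢0 (All.map⁺ (All.universal cycleLength≢0 (allFin _)))
        where
        cycleLength≢0 : ∀ b → NonZero (cycleLength b)
        cycleLength≢0 b with reach? b b
        ... | yes _ = _
        ... | no _  = _

      polynomial⇒cauchy : Polynomial (β 0) → Cauchy X
      polynomial⇒cauchy poly = conclude (proj₂ sizes r (m≤m⊔n _ _)) (proj₂ matches r (m≤n⊔m (proj₁ sizes) _))
        where
        sizes = QuasiPolynomial.eventually-newton (poly (λ _ → 1))
        matches = QuasiPolynomial.eventually-newton (poly isMatch)
        -- A common starting exponent makes lengths and matches Newton polynomials in the same
        -- variable.
        r = proj₁ sizes ⊔ proj₁ matches
        y : ℕ → ℕ
        y j = prefixLength (r + j * period)
        j≤y : ∀ j → j ≤ y j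
        j≤y j = ≤-trans (≤-trans (m≤m*n j period {{period≢0}}) (m≤n+m _ r)) (<⇒≤ (k<prefixLength (r + j * period)))
        conclude : (∃[ ds ] ∀ j → size (r + j * period) (β 0) ≡ ⟦ ds ⟧ j) →
                   (∃[ cs ] ∀ j → weight isMatch (r + j * period) (β 0) ≡ ⟦ cs ⟧ j) → Cauchy X
        -- An empty coefficient list would make y 1 zero, against 1 ≤ y 1.
        conclude ([] , y≡) _ = ⊥-elim (n≮0 (≤-trans (j≤y 1) (≤-reflexive (trans (sym (size-β (r + 1 * period))) (y≡ 1)))))
        conclude (d ∷ ds , y≡) (cs , x≡) = go (newton-ratio cs d ds
          (λ j → subst₂ _≤_ (x≡′ j) (y≡′ j) (Σ<-≤1 (y j) (λ i → indicator-≤1 (slice w i ℓ ≟* v))))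
          (λ j → subst (j ≤_) (y≡′ j) (j≤y j)))
          where
          y≡′ : ∀ j → y j ≡ ⟦ d ∷ ds ⟧ j
          y≡′ j = trans (sym (size-β (r + j * period))) (y≡ j)
          x≡′ : ∀ j → X (y j) ≡ ⟦ cs ⟧ j
          x≡′ j = trans (sym (matches-β (r + j * period))) (x≡ j)
          go : (∃[ p ] ∃[ q ] HasRatio ⟦ cs ⟧ ⟦ d ∷ ds ⟧ p (suc q)) × ⟦ ds ⟧ ≪ ⟦ d ∷ ds ⟧ → Cauchy X
          go ((p , q , ratio′) , Δ) = ratio⇒cauchy (λ i → indicator-≤1 (slice w i ℓ ≟* v)) {p} {q} ⟦ d ∷ ds ⟧ ⟦ ds ⟧
            (λ _ → refl) Δ (λ j → subst (j ≤_) (y≡′ j) (j≤y j))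
            (λ m → proj₁ (ratio′ m) , λ j J≤j →
              subst (λ x → m * (suc q * x) ≤ m * (p * ⟦ d ∷ ds ⟧ j) + ⟦ d ∷ ds ⟧ j × m * (p * ⟦ d ∷ ds ⟧ j) ≤ m * (suc q * x) + ⟦ d ∷ ds ⟧ j)
                (trans (sym (x≡′ j)) (cong X (y≡′ j))) (proj₂ (ratio′ m) j J≤j))

      matches-cauchy : (∀ a → HasFrequency fin w [ a ]) → Cauchy X
      matches-cauchy freq = [ growing⇒cauchy , polynomial⇒cauchy ]′ (grows-or-polynomial χ-nonempty (β 0))
        where
        growing⇒cauchy : Grows (β 0) → Cauchy X
        growing⇒cauchy (j , q , grows) = blocks⇒cauchy (λ i → indicator-≤1 (slice w i ℓ ≟* v)) λ C →
          let k , growth = iterate-growth (λ k → fixes-L-cauchy freq (iterate-fixes w F k)) j q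
                (λ i → subst (2 ^ i ≤_) (size-β (j + i * q)) (grows i)) C
          in fixes⇒blocks freq (iterate-fixes w F k) ℓ v C growth

  module _ {w : InfiniteWord A} {φ : List A → List A} (φ-morphism : IsMorphism φ) (φ-nonerasing : NonErasing φ)
    (φ-generates : IsPureMorphicWord φ w) where

    private
      b = proj₁ φ-generates
      u = proj₁ (proj₂ φ-generates)
      u≢[] = proj₁ (proj₂ (proj₂ φ-generates))
      φb≡bu = proj₁ (proj₂ (proj₂ (proj₂ φ-generates)))
      limit = proj₂ (proj₂ (proj₂ (proj₂ φ-generates)))

    open IsMonoidHomomorphism φ-morphism using (homo; ε-homo)

    φ-fixes : Fixes w φ
    φ-fixes = record
      { ψ-++ = homo ; ψ-[] = ε-homo ; nonerasing = λ a → nonempty⇒1≤length (φ [ a ]) (φ-nonerasing a) ; ψ-prefix = prefix }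
      where
      -- For late i, φ ^ i (b) begins with the first n letters of w and φ ^ (i + 1) (b) with the
      -- first m; applying φ to the former gives a prefix of the latter.
      prefix : ∀ n → φ (slice w 0 n) ≡ slice w 0 (length (φ (slice w 0 n)))
      prefix n = begin
        φ (slice w 0 n)
          ≡⟨ take-length-++ (φ (slice w 0 n)) (φ (drop n xs)) ⟨
        take m (φ (slice w 0 n) ++ φ (drop n xs))
          ≡⟨ cong (take m) (homo (slice w 0 n) (drop n xs)) ⟨
        take m (φ (slice w 0 n ++ drop n xs))
          ≡⟨ cong (λ ys → take m (φ (ys ++ drop n xs))) (proj₂ (limit n) i (m≤m⊔n _ _)) ⟨
        take m (φ (take n xs ++ drop n xs))                            ≡⟨ cong (take m ∘ φ) (take++drop≡id n xs) ⟩
        take m (φ xs)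
          ≡⟨ proj₂ (limit m) (suc i) (m≤n⇒m≤1+n (m≤n⊔m (proj₁ (limit n)) _)) ⟩
        slice w 0 m                                                    ∎
        where
        open ≡-Reasoning
        m = length (φ (slice w 0 n))
        i = proj₁ (limit n) ⊔ proj₁ (limit m)
        xs = fold [ b ] φ i

    w0≡b : w 0 ≡ b
    w0≡b = ∷-injectiveˡ (trans (sym (proj₂ (limit 1) i ≤-refl)) (cong (take 1) (proj₂ (head i))))
      where
      i = proj₁ (limit 1)
      head : ∀ i → ∃[ xs ] fold [ b ] φ i ≡ b ∷ xs
      head zero    = [] , refl
      head (suc i) with head i
      ... | xs , eq = u ++ φ xs , trans (cong φ eq) (trans (homo [ b ] xs) (cong (_++ φ xs) φb≡bu))

    2≤L1 : 2 ≤ Fixes.L φ-fixes 1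
    2≤L1 = subst (2 ≤_) (cong length (sym (trans (cong (λ a → φ [ a ]) w0≡b) φb≡bu))) (s≤s (nonempty⇒1≤length u u≢[]))

theorem1 : {A : Set} (fin : Finite A)
    (φ : List A → List A) → IsMorphism φ → NonErasing φ →
    (w : InfiniteWord A) → IsPureMorphicWord φ w →
    (∀ a → HasFrequency fin w [ a ]) →
    ∀ (v : List A) → IsFactor v w → HasFrequency fin w v
theorem1 fin φ φ-morphism φ-nonerasing w φ-generates freq v (t , l , v≡) =
  cauchy⇒hasLimit {occurrences fin w v} (cauchy-≗ (λ n → sym (occurrences≡Σ< fin w v length-v n))
    (matches-cauchy fin F (2≤L1 fin φ-morphism φ-nonerasing φ-generates) l v freq))
  where
  F : Fixes w φ
  F = φ-fixes fin φ-morphism φ-nonerasing φ-generates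
  length-v : length v ≡ suc l
  length-v = trans (cong length v≡) (length-slice w t (suc l))
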